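{- For any integer $k\ge1$, $$\sum_{\pi\in\mathcal{DS}^k}x^{|\pi_o|}y^{|\pi_e|}\prod_{l=1}^{k-1}u_l^{o_l(\pi)}v_l^{e_l(\pi)}=\frac{\Big(-\sum_{l=1}^{k-1}u_lx^l,\;-x^k\sum_{l=1}^{k-1}v_ly^l;\;x^ky^k\Big)_\infty}{(x^k;x^ky^k)_\infty}.$$
   Context: A partition is $k$-strict if for every $m\in\mathbb{N}$ and all $1\le r_1\le r_2\le k-1$, the numbers $mk+r_1$ and $mk+r_2$ do not appear together as parts. $\mathcal{DS}^k$ is the set of $k$-strict partitions into distinct parts. For a partition $\pi=(\pi_1\ge\pi_2\ge\cdots)$, $|\pi_o|$ (resp. $|\pi_e|$) is the sum of its odd-indexed parts $\pi_1,\pi_3,\dots$ (resp. even-indexed parts $\pi_2,\pi_4,\dots$), and for $1\le l\le k-1$, $o_l(\pi)$ (resp. $e_l(\pi)$) is the number of odd-indexed (resp. even-indexed) parts that are $\equiv l\pmod k$. $(a,b;q)_\infty=\prod_{i\ge1}(1-aq^{i-1})(1-bq^{i-1})$. -}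

module Defs where

open import Data.Nat as ℕ using (ℕ; zero; suc; _≤_; _<_; _>_; _∸_; NonZero; _%_)
open import Data.Nat.Properties using () renaming (_≟_ to _≟ℕ_)
open import Data.Integer as ℤ using (ℤ; 0ℤ; 1ℤ)
open import Data.Fin using (Fin; toℕ) renaming (_≟_ to _≟F_)
open import Data.Vec as Vec using (Vec; []; _∷_; _++_; tabulate; zipWith; replicate)
open import Data.Vec.Properties using (≡-dec)
open import Data.List as List using (List; []; _∷_; length; map; upTo; concatMap; allFin; foldr; filter; lookup)
open import Data.List.Relation.Unary.All using (All)
open import Data.List.Relation.Unary.Linked using (Linked)
open import Data.Bool using (if_then_else_)
open import Data.Nat.ListAction using (sum)
open import Relation.Nullary using (does; ¬_)
open import Relation.Binary.PropositionalEquality using (_≡_; _≢_)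
open import Data.Empty using (⊥)

DistinctPartition : List ℕ → Set
DistinctPartition π = Linked _>_ π × All (λ p → 0 < p) π
  where open import Data.Product using (_×_)

KStrict : ℕ → List ℕ → Set
KStrict k π = (m r₁ r₂ : ℕ) (i j : Fin (length π)) →
  1 ≤ r₁ → r₁ ≤ r₂ → r₂ ≤ k ∸ 1 → i ≢ j →
  lookup π i ≡ m ℕ.* k ℕ.+ r₁ → lookup π j ≡ m ℕ.* k ℕ.+ r₂ → ⊥

DS : ℕ → List ℕ → Set
DS k π = DistinctPartition π × KStrict k π
  where open import Data.Product using (_×_)

mutual
  oddParts : List ℕ → List ℕ
  oddParts []       = []
  oddParts (p ∷ ps) = p ∷ evenParts ps

  evenParts : List ℕ → List ℕ
  evenParts []       = []
  evenParts (p ∷ ps) = oddParts ps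

oddSum evenSum : List ℕ → ℕ
oddSum π  = sum (oddParts π)
evenSum π = sum (evenParts π)

countRes : (k : ℕ) .{{_ : NonZero k}} → ℕ → List ℕ → ℕ
countRes k l ps = length (filter (λ p → p % k ≟ℕ l) ps)

oCount eCount : (k : ℕ) .{{_ : NonZero k}} → ℕ → List ℕ → ℕ
oCount k l π = countRes k l (oddParts π)
eCount k l π = countRes k l (evenParts π)

-- Formal power series over ℤ in N commuting variables:
-- a series is its coefficient function on exponent vectors.

PS : ℕ → Set
PS N = Vec ℕ N → ℤ

below : ∀ {N} → Vec ℕ N → List (Vec ℕ N)
below []      = [] ∷ []
below (n ∷ e) = concatMap (λ i → map (i ∷_) (below e)) (upTo (suc n))

infixl 6 _⊕_
infixl 7 _⊗_

_⊕_ : ∀ {N} → PS N → PS N → PS N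
(f ⊕ g) e = f e ℤ.+ g e

⊝_ : ∀ {N} → PS N → PS N
(⊝ f) e = ℤ.- f e

_⊗_ : ∀ {N} → PS N → PS N → PS N
(f ⊗ g) e = List.foldr ℤ._+_ 0ℤ
  (map (λ d → f d ℤ.* g (zipWith _∸_ e d)) (below e))

mono : ∀ {N} → Vec ℕ N → PS N
mono a e = if does (≡-dec _≟ℕ_ a e) then 1ℤ else 0ℤ

one : ∀ {N} → PS N
one = mono (replicate _ 0)

sumL : ∀ {N} {A : Set} → List A → (A → PS N) → PS N
sumL xs f = foldr (λ x s → f x ⊕ s) (λ _ → 0ℤ) xs

_⊗^_ : ∀ {N} → PS N → ℕ → PS N
F ⊗^ zero  = one
F ⊗^ suc n = F ⊗ (F ⊗^ n)

prodTo : ∀ {N} → (ℕ → PS N) → ℕ → PS N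
prodTo F zero    = one
prodTo F (suc n) = prodTo F n ⊗ F (suc n)

-- Infinite product ∏_{i ≥ 1} F i, for factors with F i ≡ 1 modulo
-- terms of degree ≥ i in the first variable (x).  Then the coefficient
-- of a monomial of x-degree n is already determined by ∏_{i=1}^{n} F i,
-- and this stable value is the coefficient of the infinite product.
-- (All infinite products used below satisfy this condition.)
head0 : ∀ {N} → Vec ℕ N → ℕ
head0 []      = 0
head0 (n ∷ _) = n

infProd : ∀ {N} → (ℕ → PS N) → PS N
infProd F e = prodTo F (head0 e) e

-- Multiplicative inverse of a series with constant term 1:
-- g(0) = 1, g(e) = - Σ_{0 ≠ d ≤ e} f(d) g(e - d)  (recursion with fuel
-- = total degree).

invAux : ∀ {N} → PS N → ℕ → PS N
invAux f zero    e = one e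
invAux f (suc n) e =
  if does (≡-dec _≟ℕ_ e (replicate _ 0)) then 1ℤ
  else ℤ.- List.foldr ℤ._+_ 0ℤ
         (map (λ d → if does (≡-dec _≟ℕ_ d (replicate _ 0)) then 0ℤ
                     else f d ℤ.* invAux f n (zipWith _∸_ e d))
              (below e))

inv : ∀ {N} → PS N → PS N
inv f e = invAux f (Vec.sum e) e

poch1 : ∀ {N} → PS N → PS N → PS N
poch1 a q = infProd (λ i → one ⊕ ⊝ (a ⊗ (q ⊗^ (i ∸ 1))))

poch2 : ∀ {N} → PS N → PS N → PS N → PS N
poch2 a b q = infProd (λ i → (one ⊕ ⊝ (a ⊗ (q ⊗^ (i ∸ 1))))
                           ⊗ (one ⊕ ⊝ (b ⊗ (q ⊗^ (i ∸ 1)))))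

-- The variables of Theorem 2.6: x, y, u_1..u_{k-1}, v_1..v_{k-1}.
-- Exponent vectors are  (a ∷ b ∷ us ++ vs)  with us, vs : Vec ℕ (k-1);
-- position j : Fin (k-1) of us (resp. vs) is the exponent of u_{j+1}
-- (resp. v_{j+1}).

NV : ℕ → ℕ
NV k = suc (suc ((k ∸ 1) ℕ.+ (k ∸ 1)))

unitV : ∀ {n} → Fin n → Vec ℕ n
unitV j = tabulate (λ i → if does (i ≟F j) then 1 else 0)

zeroV : ∀ {n} → Vec ℕ n
zeroV = replicate _ 0

monoK : (k : ℕ) → ℕ → ℕ → Vec ℕ (k ∸ 1) → Vec ℕ (k ∸ 1) → PS (NV k)
monoK k a b us vs = mono (a ∷ b ∷ us ++ vs)

sumUX : (k : ℕ) → PS (NV k)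
sumUX k = sumL (allFin (k ∸ 1))
  (λ j → monoK k (suc (toℕ j)) 0 (unitV j) zeroV)

sumXVY : (k : ℕ) → PS (NV k)
sumXVY k = sumL (allFin (k ∸ 1))
  (λ j → monoK k k (suc (toℕ j)) zeroV (unitV j))

RHS : (k : ℕ) → PS (NV k)
RHS k = poch2 (⊝ sumUX k) (⊝ sumXVY k) (monoK k k k zeroV zeroV)
        ⊗ inv (poch1 (monoK k k 0 zeroV zeroV) (monoK k k k zeroV zeroV))

HasWeight : (k : ℕ) .{{_ : NonZero k}} → ℕ → ℕ → Vec ℕ (k ∸ 1) → Vec ℕ (k ∸ 1)
          → List ℕ → Set
HasWeight k a b us vs π =
  oddSum π ≡ a × evenSum π ≡ b ×
  ((j : Fin (k ∸ 1)) → oCount k (suc (toℕ j)) π ≡ Vec.lookup us j) ×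
  ((j : Fin (k ∸ 1)) → eCount k (suc (toℕ j)) π ≡ Vec.lookup vs j)
  where open import Data.Product using (_×_)

{-# OPTIONS --safe #-}
module Submission where

open import Defs
open import Algebra.Bundles using (CommutativeRing)
open import Algebra.Solver.Ring.AlmostCommutativeRing using (fromCommutativeRing; _-Raw-AlmostCommutative⟶_)
import Algebra.Solver.Ring
open import Data.Bool using (if_then_else_)
open import Data.Empty using (⊥)
open import Data.Fin as Fin using (Fin; zero; suc; toℕ)
import Data.Fin.Properties as Finₚ
open import Data.Integer as ℤ using (ℤ; +_; -[1+_]; 0ℤ; 1ℤ)
import Data.Integer.Properties as ℤₚ
open import Data.Integer.Solver using (module +-*-Solver)
open import Data.List as List using (List; []; _∷_; allFin; cartesianProductWith; concatMap; foldr; length; map; upTo)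
open import Data.List.Membership.Propositional using (_∈_; find)
open import Data.List.Membership.Propositional.Properties
  using (∈-allFin; ∈-cartesianProductWith⁺; ∈-cartesianProductWith⁻; ∈-concatMap⁻; ∈-filter⁺; ∈-filter⁻;
         ∈-lookup; ∈-map⁺; ∈-map⁻; ∈-upTo⁻; ∈-++⁺ˡ; ∈-++⁺ʳ; ∈-++⁻)
import Data.List.Properties as Listₚ
open import Data.List.Relation.Unary.All as All using (All; []; _∷_)
import Data.List.Relation.Unary.AllPairs as AllPairs
open import Data.List.Relation.Unary.Any as Any using (here; there)
import Data.List.Relation.Unary.Any.Properties as Anyₚ
open import Data.List.Relation.Unary.Linked as Linked using (Linked; []; [-]; _∷_)
import Data.List.Relation.Unary.Linked.Properties as Linkedₚ
open import Data.List.Relation.Unary.Unique.Propositional using (Unique)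
import Data.List.Relation.Unary.Unique.Propositional.Properties as Uniqueₚ
open import Data.Maybe using (Maybe; just; nothing)
open import Data.Nat as ℕ using (ℕ; NonZero; zero; suc; _∸_; _≤_; _<_; z≤n; s≤s)
import Data.Nat.DivMod as DivMod
import Data.Nat.Properties as ℕₚ
import Data.Nat.Solver as ℕSolver
open import Data.Product using (Σ; _×_; _,_; proj₁; proj₂)
open import Data.Sum using (inj₁; inj₂)
open import Data.Vec as Vec using (Vec; []; _∷_; _++_; replicate; zipWith)
import Data.Vec.Properties as Vecₚ
open import Function using (id; _∘_)
open import Function.Bundles using (_⇔_; mk⇔; Equivalence)
import Level
open import Relation.Binary.Bundles using (Setoid)
open import Relation.Binary.PropositionalEquality
  using (_≡_; _≢_; refl; cong; cong₂; subst; subst₂; sym; trans; module ≡-Reasoning)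
open import Relation.Nullary using (Dec; yes; no; does; contradiction)
open import Relation.Nullary.Decidable using (dec-true; dec-false)

-- Order the parts by position from the top and let T₀(j), T₁(j) be the generating functions
-- of the π with all parts ≤ jk whose first part counts as odd-indexed, resp. even-indexed.
-- With q = xᵏyᵏ, X = xᵏ, U = Σ uₗxˡ, W = xᵏ Σ vₗyˡ, adding one block of k consecutive part sizes
-- gives a linear recurrence for aⱼ = T₀(j) and bⱼ = Xʲ T₁(j) in which only qʲ depends on j.
-- Replacing U, W or X by its q-multiple changes (aⱼ) by a two-term relation, such as
-- aⱼ(W) = aⱼ(qW) + W (1 - qʲ) aⱼ₋₁(qW), so in the x-adic limit it multiplies a by 1/(1 + U)
-- resp. 1/(1 + W) resp. 1 - X.  Iterating, all three parameters tend to 0, where a = 1,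
-- which is the product formula.

-- Convergence is measured in x alone, which is possible because `q`, `U`, `W` and `X` are all
-- divisible by x. T₁(j) by itself is not small in this sense: a single part p, counted as
-- even-indexed, contributes y^p times at most one v and no x. The factor Xʲ repairs this: bⱼ has
-- x-order at least j, so aⱼ₊₁ and aⱼ agree modulo x^(j+1), and b leaves no trace in the limit. The
-- two-term relations live at finite j because there they follow by induction from polynomial
-- identities, jointly for a and b. Their factor 1 - q^(j+1) is visible at j = 0, where a₁ = 1 + U +
-- W + X drops by W(1 - q) when W becomes qW; in the limit it tends to 1. To read off the
-- coefficient of x^n, the index j = n and n rounds of shifts are enough. The combinatorial side has
-- a matching bound: the largest part is odd-indexed, so |πₒ| = n forces all parts to be at most n,
-- hence at most nk, and a finite enumeration contains everything to be counted.

-- Solving ring identities with integer coefficients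

module IntegerCoefficients {c ℓ} (R : CommutativeRing c ℓ) where
  private module R = CommutativeRing R
  open R using (Carrier; _≈_; 0#; 1#; setoid)
  open import Algebra.Properties.Ring R.ring
    using (-0#≈0#; -‿distribˡ-*; -‿distribʳ-*; -‿involutive; -‿+-comm)
  open import Algebra.Properties.Semiring.Mult.TCOptimised R.semiring renaming (_×_ to _·_)
  open import Relation.Binary.Reasoning.Setoid setoid

  -- Normal forms must detect cancelling coefficients. Equality of power series, which are
  -- functions, cannot be decided, so the coefficients are taken from ℤ through the canonical map.
  -- With this `_·_`, the element `1 · 1#` computes to `1#`, so that `con 1ℤ` denotes `1#` itself.
  ⟦_⟧ : ℤ → Carrier
  ⟦ + n ⟧      = n · 1#
  ⟦ -[1+ n ] ⟧ = R.- (suc n · 1#)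

  ⟦⟧-neg : ∀ i → ⟦ ℤ.- i ⟧ ≈ R.- ⟦ i ⟧
  ⟦⟧-neg (+ zero)   = R.sym -0#≈0#
  ⟦⟧-neg (+ suc n)  = R.refl
  ⟦⟧-neg -[1+ n ]   = R.sym (-‿involutive _)

  ⟦⟧-⊖ : ∀ m n → ⟦ m ℤ.⊖ n ⟧ ≈ m · 1# R.+ R.- (n · 1#)
  ⟦⟧-⊖ zero zero = begin
    0#              ≈⟨ R.-‿inverseʳ 0# ⟨
    0# R.+ R.- 0#   ∎
  ⟦⟧-⊖ zero (suc n) = R.sym (R.+-identityˡ _)
  ⟦⟧-⊖ (suc m) zero = begin
    suc m · 1#               ≈⟨ R.+-identityʳ _ ⟨
    suc m · 1# R.+ 0#        ≈⟨ R.+-congˡ -0#≈0# ⟨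
    suc m · 1# R.+ R.- 0#    ∎
  ⟦⟧-⊖ (suc m) (suc n) = begin
    ⟦ suc m ℤ.⊖ suc n ⟧                           ≡⟨ cong ⟦_⟧ (ℤₚ.[1+m]⊖[1+n]≡m⊖n m n) ⟩
    ⟦ m ℤ.⊖ n ⟧                                   ≈⟨ ⟦⟧-⊖ m n ⟩
    M R.+ R.- N                                   ≈⟨ R.+-congʳ (R.+-identityˡ M) ⟨
    0# R.+ M R.+ R.- N                            ≈⟨ R.+-congʳ (R.+-congʳ (R.-‿inverseʳ 1#)) ⟨
    1# R.+ R.- 1# R.+ M R.+ R.- N                 ≈⟨ R.+-congʳ (R.+-assoc _ _ _) ⟩
    1# R.+ (R.- 1# R.+ M) R.+ R.- N               ≈⟨ R.+-congʳ (R.+-congˡ (R.+-comm _ _)) ⟩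
    1# R.+ (M R.+ R.- 1#) R.+ R.- N               ≈⟨ R.+-congʳ (R.+-assoc _ _ _) ⟨
    1# R.+ M R.+ R.- 1# R.+ R.- N                 ≈⟨ R.+-assoc _ _ _ ⟩
    1# R.+ M R.+ (R.- 1# R.+ R.- N)               ≈⟨ R.+-congˡ (-‿+-comm 1# N) ⟩
    1# R.+ M R.+ R.- (1# R.+ N)                   ≈⟨ R.+-cong (1+× m 1#) (R.-‿cong (1+× n 1#)) ⟨
    suc m · 1# R.+ R.- (suc n · 1#)               ∎
    where
    M N : Carrier
    M = m · 1#
    N = n · 1#

  ⟦⟧-+ : ∀ i j → ⟦ i ℤ.+ j ⟧ ≈ ⟦ i ⟧ R.+ ⟦ j ⟧
  ⟦⟧-+ (+ m)    (+ n)    = ×-homo-+ 1# m n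
  ⟦⟧-+ (+ m)    -[1+ n ] = ⟦⟧-⊖ m (suc n)
  ⟦⟧-+ -[1+ m ] (+ n)    = R.trans (⟦⟧-⊖ n (suc m)) (R.+-comm _ _)
  ⟦⟧-+ -[1+ m ] -[1+ n ] = begin
    R.- (suc (suc (m ℕ.+ n)) · 1#)              ≡⟨ cong (λ t → R.- (t · 1#)) (cong suc (ℕₚ.+-suc m n)) ⟨
    R.- ((suc m ℕ.+ suc n) · 1#)                ≈⟨ R.-‿cong (×-homo-+ 1# (suc m) (suc n)) ⟩
    R.- (suc m · 1# R.+ suc n · 1#)             ≈⟨ -‿+-comm _ _ ⟨
    R.- (suc m · 1#) R.+ R.- (suc n · 1#)       ∎

  ⟦⟧-+* : ∀ m j → ⟦ + m ℤ.* j ⟧ ≈ ⟦ + m ⟧ R.* ⟦ j ⟧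
  ⟦⟧-+* m (+ n) = begin
    ⟦ + m ℤ.* + n ⟧        ≡⟨ cong ⟦_⟧ (ℤₚ.pos-* m n) ⟨
    (m ℕ.* n) · 1#         ≈⟨ ×1-homo-* m n ⟩
    m · 1# R.* n · 1#      ∎
  ⟦⟧-+* m -[1+ n ] = begin
    ⟦ + m ℤ.* ℤ.- + suc n ⟧          ≡⟨ cong ⟦_⟧ (ℤₚ.neg-distribʳ-* (+ m) (+ suc n)) ⟨
    ⟦ ℤ.- (+ m ℤ.* + suc n) ⟧        ≈⟨ ⟦⟧-neg (+ m ℤ.* + suc n) ⟩
    R.- ⟦ + m ℤ.* + suc n ⟧          ≈⟨ R.-‿cong (⟦⟧-+* m (+ suc n)) ⟩
    R.- (m · 1# R.* suc n · 1#)      ≈⟨ -‿distribʳ-* _ _ ⟩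
    m · 1# R.* R.- (suc n · 1#)      ∎

  ⟦⟧-* : ∀ i j → ⟦ i ℤ.* j ⟧ ≈ ⟦ i ⟧ R.* ⟦ j ⟧
  ⟦⟧-* (+ m) j = ⟦⟧-+* m j
  ⟦⟧-* -[1+ m ] j = begin
    ⟦ ℤ.- + suc m ℤ.* j ⟧            ≡⟨ cong ⟦_⟧ (ℤₚ.neg-distribˡ-* (+ suc m) j) ⟨
    ⟦ ℤ.- (+ suc m ℤ.* j) ⟧          ≈⟨ ⟦⟧-neg (+ suc m ℤ.* j) ⟩
    R.- ⟦ + suc m ℤ.* j ⟧            ≈⟨ R.-‿cong (⟦⟧-+* (suc m) j) ⟩
    R.- (suc m · 1# R.* ⟦ j ⟧)       ≈⟨ -‿distribˡ-* _ _ ⟩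
    R.- (suc m · 1#) R.* ⟦ j ⟧       ∎

  ⟦⟧-morphism : ℤ.+-*-rawRing -Raw-AlmostCommutative⟶ fromCommutativeRing R
  ⟦⟧-morphism = record
    { ⟦_⟧    = ⟦_⟧
    ; +-homo = ⟦⟧-+
    ; *-homo = ⟦⟧-*
    ; -‿homo = ⟦⟧-neg
    ; 0-homo = R.refl
    ; 1-homo = R.refl
    }

  private
    _≟⟦⟧_ : ∀ i j → Maybe (⟦ i ⟧ ≈ ⟦ j ⟧)
    i ≟⟦⟧ j with i ℤ.≟ j
    ... | yes eq = just (R.reflexive (cong ⟦_⟧ eq))
    ... | no _   = nothing

  open Algebra.Solver.Ring ℤ.+-*-rawRing (fromCommutativeRing R) ⟦⟧-morphism _≟⟦⟧_
    public using (solve; _:=_; _:+_; _:*_; _:-_; :-_; con; Polynomial)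

-- The recurrence and its limit

module Recurrence {c ℓ} (R : CommutativeRing c ℓ) where
  open CommutativeRing R renaming (refl to ≈-refl; sym to ≈-sym; trans to ≈-trans; reflexive to ≈-reflexive)
  open IntegerCoefficients R
  open import Relation.Binary.Reasoning.Setoid setoid

  infixr 8 _^_
  _^_ : Carrier → ℕ → Carrier
  q ^ zero  = 1#
  q ^ suc n = q * q ^ n

  module _ (q : Carrier) where

    mutual
      -- `U`, `W`, `X` are arguments while `q` is fixed, since the relations below compare sequences
      -- in which one of the three has been multiplied by `q`.
      a : (U W X : Carrier) → ℕ → Carrier
      a U W X zero    = 1#
      a U W X (suc j) = (1# + W * q ^ j) * a U W X j + (U + X) * b U W X j

      b : (U W X : Carrier) → ℕ → Carrier
      b U W X zero    = 1#
      b U W X (suc j) = (q ^ suc j + W * q ^ j) * a U W X j + (X + q ^ suc j * U) * b U W X j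

    private
      𝟙 : ∀ {n} → Polynomial n
      𝟙 = con 1ℤ
      stepA stepB : ∀ {n} (q U W X z α β : Polynomial n) → Polynomial n
      stepA q U W X z α β = (𝟙 :+ W :* z) :* α :+ (U :+ X) :* β
      stepB q U W X z α β = (q :* z :+ W :* z) :* α :+ (X :+ q :* z :* U) :* β

    -- Write a′, b′ for the sequences at q * W. The coefficient W * q^(j+1) in the step of a from
    -- j+1 equals (q * W) * q^j, that of a′ in the step from j. By linearity the corrections W(1 -
    -- q^(j+1)) times a′ⱼ and b′ⱼ are carried to the same multiple of a′ⱼ₊₁, and the leftover W
    -- q^(j+1) (1 - q) a′ⱼ₊₁ completes the factor to 1 - q^(j+2). The relation for a consumes the
    -- one for b, hence the joint induction.
    ab-shift-W : ∀ U W X j →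
      a U W X (suc j) ≈ a U (q * W) X (suc j) + W * (1# - q ^ suc j) * a U (q * W) X j ×
      b U W X (suc j) ≈ b U (q * W) X (suc j) + W * (1# - q ^ suc j) * b U (q * W) X j
    ab-shift-W U W X zero =
      solve 4 (λ q U W X → stepA q U W X 𝟙 𝟙 𝟙
        := stepA q U (q :* W) X 𝟙 𝟙 𝟙 :+ W :* (𝟙 :- q :* 𝟙) :* 𝟙) ≈-refl q U W X ,
      solve 4 (λ q U W X → stepB q U W X 𝟙 𝟙 𝟙
        := stepB q U (q :* W) X 𝟙 𝟙 𝟙 :+ W :* (𝟙 :- q :* 𝟙) :* 𝟙) ≈-refl q U W X
    ab-shift-W U W X (suc j) with ab-shift-W U W X j
    ... | ihA , ihB =
      ≈-trans (+-cong (*-congˡ ihA) (*-congˡ ihB))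
       (solve 7 (λ q U W X z α β →
          let α' = stepA q U (q :* W) X z α β
              β' = stepB q U (q :* W) X z α β
              r  = W :* (𝟙 :- q :* z)
          in stepA q U W X (q :* z) (α' :+ r :* α) (β' :+ r :* β)
            := stepA q U (q :* W) X (q :* z) α' β' :+ W :* (𝟙 :- q :* (q :* z)) :* α')
         ≈-refl q U W X (q ^ j) (a U (q * W) X j) (b U (q * W) X j)) ,
      ≈-trans (+-cong (*-congˡ ihA) (*-congˡ ihB))
       (solve 7 (λ q U W X z α β →
          let α' = stepA q U (q :* W) X z α β
              β' = stepB q U (q :* W) X z α β
              r  = W :* (𝟙 :- q :* z)
          in stepB q U W X (q :* z) (α' :+ r :* α) (β' :+ r :* β)
            := stepB q U (q :* W) X (q :* z) α' β' :+ W :* (𝟙 :- q :* (q :* z)) :* β')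
         ≈-refl q U W X (q ^ j) (a U (q * W) X j) (b U (q * W) X j))

    -- The additional `q` in the second component is forced at j = 0: there `U` enters b₁ = q + W +
    -- X + qU only through qU.
    ab-shift-U : ∀ U W X j →
      a U W X (suc j) ≈ a (q * U) W X (suc j) + U * (1# - q ^ suc j) * a (q * U) W X j ×
      b U W X (suc j) ≈ b (q * U) W X (suc j) + q * U * (1# - q ^ suc j) * b (q * U) W X j
    ab-shift-U U W X zero =
      solve 4 (λ q U W X → stepA q U W X 𝟙 𝟙 𝟙
        := stepA q (q :* U) W X 𝟙 𝟙 𝟙 :+ U :* (𝟙 :- q :* 𝟙) :* 𝟙) ≈-refl q U W X ,
      solve 4 (λ q U W X → stepB q U W X 𝟙 𝟙 𝟙
        := stepB q (q :* U) W X 𝟙 𝟙 𝟙 :+ q :* U :* (𝟙 :- q :* 𝟙) :* 𝟙) ≈-refl q U W X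
    ab-shift-U U W X (suc j) with ab-shift-U U W X j
    ... | ihA , ihB =
      ≈-trans (+-cong (*-congˡ ihA) (*-congˡ ihB))
       (solve 7 (λ q U W X z α β →
          let α' = stepA q (q :* U) W X z α β
              β' = stepB q (q :* U) W X z α β
              r  = 𝟙 :- q :* z
          in stepA q U W X (q :* z) (α' :+ U :* r :* α) (β' :+ q :* U :* r :* β)
            := stepA q (q :* U) W X (q :* z) α' β' :+ U :* (𝟙 :- q :* (q :* z)) :* α')
         ≈-refl q U W X (q ^ j) (a (q * U) W X j) (b (q * U) W X j)) ,
      ≈-trans (+-cong (*-congˡ ihA) (*-congˡ ihB))
       (solve 7 (λ q U W X z α β →
          let α' = stepA q (q :* U) W X z α β
              β' = stepB q (q :* U) W X z α β
              r  = 𝟙 :- q :* z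
          in stepB q U W X (q :* z) (α' :+ U :* r :* α) (β' :+ q :* U :* r :* β)
            := stepB q (q :* U) W X (q :* z) α' β' :+ q :* U :* (𝟙 :- q :* (q :* z)) :* β')
         ≈-refl q U W X (q ^ j) (a (q * U) W X j) (b (q * U) W X j))

    -- Here the shifted sequence is expressed through the unshifted one, the reverse of the two
    -- relations above. This is why `X` ends up in the denominator: the limit is multiplied by 1 - X
    -- when `X` becomes q * X.
    ab-shift-X : ∀ U W X j →
      a U W (q * X) (suc j) ≈ a U W X (suc j) - X * (1# - q ^ suc j) * a U W X j ×
      b U W (q * X) (suc j) ≈ b U W X (suc j) - X * (1# - q ^ suc j) * b U W X j
    ab-shift-X U W X zero =
      solve 4 (λ q U W X → stepA q U W (q :* X) 𝟙 𝟙 𝟙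
        := stepA q U W X 𝟙 𝟙 𝟙 :- X :* (𝟙 :- q :* 𝟙) :* 𝟙) ≈-refl q U W X ,
      solve 4 (λ q U W X → stepB q U W (q :* X) 𝟙 𝟙 𝟙
        := stepB q U W X 𝟙 𝟙 𝟙 :- X :* (𝟙 :- q :* 𝟙) :* 𝟙) ≈-refl q U W X
    ab-shift-X U W X (suc j) with ab-shift-X U W X j
    ... | ihA , ihB =
      ≈-trans (+-cong (*-congˡ ihA) (*-congˡ ihB))
       (solve 7 (λ q U W X z α β →
          let α' = stepA q U W X z α β
              β' = stepB q U W X z α β
              r  = X :* (𝟙 :- q :* z)
          in stepA q U W (q :* X) (q :* z) (α' :- r :* α) (β' :- r :* β)
            := stepA q U W X (q :* z) α' β' :- X :* (𝟙 :- q :* (q :* z)) :* α')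
         ≈-refl q U W X (q ^ j) (a U W X j) (b U W X j)) ,
      ≈-trans (+-cong (*-congˡ ihA) (*-congˡ ihB))
       (solve 7 (λ q U W X z α β →
          let α' = stepA q U W X z α β
              β' = stepB q U W X z α β
              r  = X :* (𝟙 :- q :* z)
          in stepB q U W (q :* X) (q :* z) (α' :- r :* α) (β' :- r :* β)
            := stepB q U W X (q :* z) α' β' :- X :* (𝟙 :- q :* (q :* z)) :* β')
         ≈-refl q U W X (q ^ j) (a U W X j) (b U W X j))

  -- Filtrations, congruences and the limit of a

  -- The model is `I n` = multiples of x^n. `I₀` and `I-*` together make each `I n` an ideal;
  -- multiplication by -1 then gives the symmetry of the congruence `_≈[_]_`.
  record IsFiltration {i} (I : ℕ → Carrier → Set i) : Set (c Level.⊔ ℓ Level.⊔ i) where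
    field
      resp : ∀ {n x y} → x ≈ y → I n x → I n y
      anti : ∀ {m n x} → m ≤ n → I n x → I m x
      I-0  : ∀ {n} → I n 0#
      I₀   : ∀ {x} → I 0 x
      I-+  : ∀ {n x y} → I n x → I n y → I n (x + y)
      I-*  : ∀ {m n x y} → I m x → I n y → I (m ℕ.+ n) (x * y)

    I-*ˡ : ∀ {n x y} → I n y → I n (x * y)
    I-*ˡ = I-* I₀

    I-*ʳ : ∀ {n x y} → I n x → I n (x * y)
    I-*ʳ {n} {x} {y} p = resp (*-comm y x) (I-*ˡ p)

    infix 4 _≈[_]_
    _≈[_]_ : Carrier → ℕ → Carrier → Set i
    x ≈[ n ] y = I n (x - y)

    ≈⇒≈[] : ∀ {n x y} → x ≈ y → x ≈[ n ] y
    ≈⇒≈[] {n} {x} {y} p = resp (≈-trans (≈-sym (-‿inverseʳ y)) (+-congʳ (≈-sym p))) I-0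

    ≈[]-sym : ∀ {n x y} → x ≈[ n ] y → y ≈[ n ] x
    ≈[]-sym {n} {x} {y} p =
      resp (solve 2 (λ x y → (:- con 1ℤ) :* (x :- y) := y :- x) ≈-refl x y) (I-*ˡ p)

    ≈[]-trans : ∀ {n x y z} → x ≈[ n ] y → y ≈[ n ] z → x ≈[ n ] z
    ≈[]-trans {n} {x} {y} {z} p r =
      resp (solve 3 (λ x y z → (x :- y) :+ (y :- z) := x :- z) ≈-refl x y z) (I-+ p r)

    ≈[]-*ˡ : ∀ {n y z} x → y ≈[ n ] z → x * y ≈[ n ] x * z
    ≈[]-*ˡ {n} {y} {z} x p =
      resp (solve 3 (λ x y z → x :* (y :- z) := x :* y :- x :* z) ≈-refl x y z) (I-*ˡ p)

    ≈[]-setoid : ℕ → Setoid c i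
    ≈[]-setoid n = record
      { _≈_ = _≈[ n ]_
      ; isEquivalence = record
        { refl  = ≈⇒≈[] ≈-refl ; sym = ≈[]-sym ; trans = ≈[]-trans } }

  ∏ : (ℕ → Carrier) → ℕ → Carrier
  ∏ F zero    = 1#
  ∏ F (suc n) = ∏ F n * F (suc n)

  module Limit {i} {I : ℕ → Carrier → Set i} (isFiltration : IsFiltration I)
               (q : Carrier) (q∈I₁ : I 1 q) where
    open IsFiltration isFiltration

    q^∈I : ∀ j → I j (q ^ j)
    q^∈I zero    = I₀
    q^∈I (suc j) = I-* q∈I₁ (q^∈I j)

    -- Built by repeated left multiplication, so that one more shift of the parameters in
    -- `a-iterate` holds by computation; `iterate≈` gives the closed form that the Pochhammer
    -- factors need.
    iterate : Carrier → ℕ → Carrier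
    iterate x zero    = x
    iterate x (suc m) = q * iterate x m

    iterate∈I : ∀ {x} → I 1 x → ∀ m → I (suc m) (iterate x m)
    iterate∈I p zero    = p
    iterate∈I p (suc m) = I-* q∈I₁ (iterate∈I p m)

    iterate≈ : ∀ x m → iterate x m ≈ x * q ^ m
    iterate≈ x zero    = ≈-sym (*-identityʳ x)
    iterate≈ x (suc m) = ≈-trans (*-congˡ (iterate≈ x m))
      (solve 3 (λ q x z → q :* (x :* z) := x :* (q :* z)) ≈-refl q x (q ^ m))

    -- Each step raises the order by one: the coefficient of a contains q^j times a further `q` or
    -- `W`, and both summands in the coefficient of b, `X` and q^(j+1) * U, lie in `I 1`.
    b∈I : ∀ {U W X} → I 1 W → I 1 X → ∀ j → I j (b q U W X j)
    b∈I W∈ X∈ zero    = I₀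
    b∈I W∈ X∈ (suc j) = I-+
      (I-*ʳ (I-+ (q^∈I (suc j)) (I-* W∈ (q^∈I j))))
      (I-* (I-+ X∈ (I-*ʳ (I-*ʳ q∈I₁))) (b∈I W∈ X∈ j))

    a-step : ∀ U W X j →
      a q U W X (suc j) - a q U W X j ≈ W * q ^ j * a q U W X j + (U + X) * b q U W X j
    a-step U W X j = solve 6
      (λ U W X z α β → ((con 1ℤ :+ W :* z) :* α :+ (U :+ X) :* β) :- α
         := W :* z :* α :+ (U :+ X) :* β)
      ≈-refl U W X (q ^ j) (a q U W X j) (b q U W X j)

    module _ {U W X : Carrier} (U∈ : I 1 U) (W∈ : I 1 W) (X∈ : I 1 X) where

      a-stable : ∀ j → a q U W X (suc j) ≈[ suc j ] a q U W X j
      a-stable j = resp (≈-sym (a-step U W X j))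
        (I-+ (I-*ʳ (I-* W∈ (q^∈I j))) (I-* (I-+ U∈ X∈) (b∈I W∈ X∈ j)))

    -- For U = W = X = 0 the sequence is constantly 1. The bound is uniform in j because every
    -- increment of a is a combination of `W` and U + X.
    a-small : ∀ {n U W X} → I n U → I n W → I n X → ∀ j → a q U W X j ≈[ n ] 1#
    a-small U∈ W∈ X∈ zero    = ≈⇒≈[] ≈-refl
    a-small U∈ W∈ X∈ (suc j) = ≈[]-trans
      (resp (≈-sym (a-step _ _ _ j)) (I-+ (I-*ʳ (I-*ʳ W∈)) (I-*ʳ (I-+ U∈ X∈))))
      (a-small U∈ W∈ X∈ j)

    module _ {U W X : Carrier} (U∈ : I 1 U) (W∈ : I 1 W) (X∈ : I 1 X) (n : ℕ) where
      open import Relation.Binary.Reasoning.Setoid (≈[]-setoid (suc n)) as ~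

      private
        qU∈ : I 1 (q * U)
        qU∈ = I-*ˡ U∈
        qW∈ : I 1 (q * W)
        qW∈ = I-*ˡ W∈
        qX∈ : I 1 (q * X)
        qX∈ = I-*ˡ X∈

      -- Modulo `I (suc n)` the terms with index n and n+1 coincide and q^(n+1) vanishes, so the
      -- two-term relation collapses to a single factor. The other two parameters are treated alike.
      a-shift-W-limit : a q U W X n ≈[ suc n ] (1# + W) * a q U (q * W) X n
      a-shift-W-limit = ~.begin
        a q U W X n        ~.≈⟨ a-stable U∈ W∈ X∈ n ⟨
        a q U W X (suc n)  ~.≈⟨ ≈⇒≈[] (proj₁ (ab-shift-W q U W X n)) ⟩
        a′ (suc n) + W * (1# - q ^ suc n) * a′ n
          ~.≈⟨ resp (solve 5 (λ q W z α β → (β :- α) :+ (:- (W :* α)) :* (q :* z)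
                   := (β :+ W :* (con 1ℤ :- q :* z) :* α) :- (con 1ℤ :+ W) :* α)
                 ≈-refl q W (q ^ n) (a′ n) (a′ (suc n)))
               (I-+ (a-stable U∈ qW∈ X∈ n) (I-*ˡ (q^∈I (suc n)))) ⟩
        (1# + W) * a′ n    ~.∎
        where
        a′ : ℕ → Carrier
        a′ = a q U (q * W) X

      a-shift-U-limit : a q U W X n ≈[ suc n ] (1# + U) * a q (q * U) W X n
      a-shift-U-limit = ~.begin
        a q U W X n        ~.≈⟨ a-stable U∈ W∈ X∈ n ⟨
        a q U W X (suc n)  ~.≈⟨ ≈⇒≈[] (proj₁ (ab-shift-U q U W X n)) ⟩
        a′ (suc n) + U * (1# - q ^ suc n) * a′ n
          ~.≈⟨ resp (solve 5 (λ q U z α β → (β :- α) :+ (:- (U :* α)) :* (q :* z)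
                   := (β :+ U :* (con 1ℤ :- q :* z) :* α) :- (con 1ℤ :+ U) :* α)
                 ≈-refl q U (q ^ n) (a′ n) (a′ (suc n)))
               (I-+ (a-stable qU∈ W∈ X∈ n) (I-*ˡ (q^∈I (suc n)))) ⟩
        (1# + U) * a′ n    ~.∎
        where
        a′ : ℕ → Carrier
        a′ = a q (q * U) W X

      a-shift-X-limit : (1# - X) * a q U W X n ≈[ suc n ] a q U W (q * X) n
      a-shift-X-limit = ~.begin
        (1# - X) * α n
          ~.≈⟨ resp (solve 5 (λ q X z α β → (α :- β) :+ (:- (X :* α)) :* (q :* z)
                   := (con 1ℤ :- X) :* α :- (β :- X :* (con 1ℤ :- q :* z) :* α))
                 ≈-refl q X (q ^ n) (α n) (α (suc n)))
               (I-+ (≈[]-sym (a-stable U∈ W∈ X∈ n)) (I-*ˡ (q^∈I (suc n)))) ⟩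
        α (suc n) - X * (1# - q ^ suc n) * α n
                                 ~.≈⟨ ≈⇒≈[] (proj₁ (ab-shift-X q U W X n)) ⟨
        a q U W (q * X) (suc n)  ~.≈⟨ a-stable U∈ W∈ qX∈ n ⟩
        a q U W (q * X) n        ~.∎
        where
        α : ℕ → Carrier
        α = a q U W X

    a-shift-limit : ∀ {U W X} → I 1 U → I 1 W → I 1 X → ∀ n →
      (1# - X) * a q U W X n ≈[ suc n ] (1# + U) * (1# + W) * a q (q * U) (q * W) (q * X) n
    a-shift-limit {U} {W} {X} U∈ W∈ X∈ n = ~.begin
      (1# - X) * a q U W X n                              ~.≈⟨ a-shift-X-limit U∈ W∈ X∈ n ⟩
      a q U W (q * X) n                                   ~.≈⟨ a-shift-U-limit U∈ W∈ qX∈ n ⟩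
      (1# + U) * a q (q * U) W (q * X) n
        ~.≈⟨ ≈[]-*ˡ (1# + U) (a-shift-W-limit (I-*ˡ U∈) W∈ qX∈ n) ⟩
      (1# + U) * ((1# + W) * a q (q * U) (q * W) (q * X) n) ~.≈⟨ ≈⇒≈[] (*-assoc _ _ _) ⟨
      (1# + U) * (1# + W) * a q (q * U) (q * W) (q * X) n  ~.∎
      where
      open import Relation.Binary.Reasoning.Setoid (≈[]-setoid (suc n)) as ~
      qX∈ : I 1 (q * X)
      qX∈ = I-*ˡ X∈

    pochFactor : Carrier → ℕ → Carrier
    pochFactor x i = 1# + - (x * q ^ (i ∸ 1))

    pochFactor-stable : ∀ {x} → I 1 x → ∀ j → pochFactor x (suc j) ≈[ suc j ] 1#
    pochFactor-stable {x} x∈ j =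
      resp (solve 2 (λ x z → (:- con 1ℤ) :* (x :* z) := (con 1ℤ :+ :- (x :* z)) :- con 1ℤ) ≈-refl x (q ^ j))
        (I-*ˡ (I-* x∈ (q^∈I j)))

    module _ {U W X : Carrier} (U∈ : I 1 U) (W∈ : I 1 W) (X∈ : I 1 X) where

      pochFactor₂ : ℕ → Carrier
      pochFactor₂ i = pochFactor (- U) i * pochFactor (- W) i

      -- The denominator stays on the left as a product, so the statement makes sense in any
      -- filtered commutative ring; inverses enter only for power series.
      a-iterate : ∀ n m → ∏ (pochFactor X) m * a q U W X n
        ≈[ suc n ] ∏ pochFactor₂ m * a q (iterate U m) (iterate W m) (iterate X m) n
      a-iterate n zero    = ≈⇒≈[] ≈-refl
      a-iterate n (suc m) = ~.begin
        P * f * α₀             ~.≈⟨ ≈⇒≈[] (solve 3 (λ P f α → P :* f :* α := f :* (P :* α)) ≈-refl P f α₀) ⟩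
        f * (P * α₀)           ~.≈⟨ ≈[]-*ˡ f (a-iterate n m) ⟩
        f * (Q * α)            ~.≈⟨ ≈⇒≈[] (solve 3 (λ f Q α → f :* (Q :* α) := Q :* (f :* α)) ≈-refl f Q α) ⟩
        Q * (f * α)            ~.≈⟨ ≈⇒≈[] (*-congˡ (*-congʳ (+-congˡ (-‿cong (≈-sym (iterate≈ X m)))))) ⟩
        Q * ((1# - iterate X m) * α)
          ~.≈⟨ ≈[]-*ˡ Q (a-shift-limit (anti (s≤s z≤n) (iterate∈I U∈ m))
                 (anti (s≤s z≤n) (iterate∈I W∈ m)) (anti (s≤s z≤n) (iterate∈I X∈ m)) n) ⟩
        Q * ((1# + iterate U m) * (1# + iterate W m) * α′)
          ~.≈⟨ ≈⇒≈[] (*-congˡ (*-congʳ (*-cong (1+iterate≈ U) (1+iterate≈ W)))) ⟩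
        Q * (pochFactor₂ (suc m) * α′)  ~.≈⟨ ≈⇒≈[] (*-assoc _ _ _) ⟨
        Q * pochFactor₂ (suc m) * α′    ~.∎
        where
        open import Relation.Binary.Reasoning.Setoid (≈[]-setoid (suc n)) as ~
        P f Q α₀ α α′ : Carrier
        P  = ∏ (pochFactor X) m
        f  = pochFactor X (suc m)
        Q  = ∏ pochFactor₂ m
        α₀ = a q U W X n
        α  = a q (iterate U m) (iterate W m) (iterate X m) n
        α′ = a q (iterate U (suc m)) (iterate W (suc m)) (iterate X (suc m)) n
        1+iterate≈ : ∀ x → 1# + iterate x m ≈ pochFactor (- x) (suc m)
        1+iterate≈ x = ≈-trans (+-congˡ (iterate≈ x m))
          (solve 2 (λ x z → con 1ℤ :+ x :* z := con 1ℤ :+ :- ((:- x) :* z)) ≈-refl x (q ^ m))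

      -- After n rounds the parameters are U q^n, W q^n, X q^n, which lie in `I (suc n)`, so the
      -- remaining a is 1 to the required precision.
      a-limit : ∀ n → ∏ (pochFactor X) n * a q U W X n ≈[ suc n ] ∏ pochFactor₂ n
      a-limit n = ≈[]-trans (a-iterate n n) (≈[]-trans
        (≈[]-*ˡ (∏ pochFactor₂ n) (a-small (iterate∈I U∈ n) (iterate∈I W∈ n) (iterate∈I X∈ n) n))
        (≈⇒≈[] (*-identityʳ _)))

  ^-distrib-* : ∀ x y n → (x * y) ^ n ≈ x ^ n * y ^ n
  ^-distrib-* x y zero    = ≈-sym (*-identityʳ 1#)
  ^-distrib-* x y (suc n) = ≈-trans (*-congˡ (^-distrib-* x y n))
    (solve 4 (λ x y u v → x :* y :* (u :* v) := x :* u :* (y :* v)) ≈-refl x y (x ^ n) (y ^ n))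

  ^-congˡ : ∀ {x y} n → x ≈ y → x ^ n ≈ y ^ n
  ^-congˡ zero    p = ≈-refl
  ^-congˡ (suc n) p = *-cong p (^-congˡ n p)

  module _ {q U V W X Y : Carrier} (q≈ : q ≈ X * Y) (W≈ : W ≈ X * V) (t₀ t₁ : ℕ → Carrier)
    (t₀-zero : t₀ 0 ≈ 1#) (t₁-zero : t₁ 0 ≈ 1#)
    (t₀-suc : ∀ m → t₀ (suc m) ≈
      (t₀ m + U * X ^ m * t₁ m) + X ^ suc m * (t₁ m + V * Y ^ m * t₀ m))
    (t₁-suc : ∀ m → t₁ (suc m) ≈
      (t₁ m + V * Y ^ m * t₀ m) + Y ^ suc m * (t₀ m + U * X ^ m * t₁ m)) where

    private
      q^≈ : ∀ m → q ^ m ≈ X ^ m * Y ^ m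
      q^≈ m = ≈-trans (^-congˡ m q≈) (^-distrib-* X Y m)

    -- In the recurrence of `t₀`, Y^m occurs only beside X^(m+1), where it gives W * q^m. In that of
    -- `t₁`, multiplication by X^(m+1) supplies the partner of every power of `Y`; the powers of `X`
    -- that remain are absorbed into b.
    t₀≈a×X^t₁≈b : ∀ m → t₀ m ≈ a q U W X m × X ^ m * t₁ m ≈ b q U W X m
    t₀≈a×X^t₁≈b zero    = t₀-zero , ≈-trans (*-identityˡ _) t₁-zero
    t₀≈a×X^t₁≈b (suc m) with t₀≈a×X^t₁≈b m
    ... | ih₀ , ih₁ =
      (begin
        t₀ (suc m) ≈⟨ t₀-suc m ⟩
        _          ≈⟨ solve 8 (λ U V X Y x y t s →
                        (t :+ U :* x :* s) :+ X :* x :* (s :+ V :* y :* t)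
                        := (con 1ℤ :+ (X :* V) :* (x :* y)) :* t :+ (U :+ X) :* (x :* s))
                        ≈-refl U V X Y (X ^ m) (Y ^ m) (t₀ m) (t₁ m) ⟩
        (1# + X * V * (X ^ m * Y ^ m)) * t₀ m + (U + X) * (X ^ m * t₁ m)
                   ≈⟨ +-cong (*-cong (+-congˡ (*-cong W≈ (q^≈ m))) (≈-sym ih₀)) (*-congˡ (≈-sym ih₁)) ⟨
        a q U W X (suc m) ∎) ,
      (begin
        X ^ suc m * t₁ (suc m) ≈⟨ *-congˡ (t₁-suc m) ⟩
        _          ≈⟨ solve 8 (λ U V X Y x y t s →
                        X :* x :* ((s :+ V :* y :* t) :+ Y :* y :* (t :+ U :* x :* s))
                        := ((X :* x) :* (Y :* y) :+ (X :* V) :* (x :* y)) :* t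
                             :+ (X :+ (X :* x) :* (Y :* y) :* U) :* (x :* s))
                        ≈-refl U V X Y (X ^ m) (Y ^ m) (t₀ m) (t₁ m) ⟩
        (X ^ suc m * Y ^ suc m + X * V * (X ^ m * Y ^ m)) * t₀ m
          + (X + X ^ suc m * Y ^ suc m * U) * (X ^ m * t₁ m)
                   ≈⟨ +-cong (*-cong (+-cong (q^≈ (suc m)) (*-cong W≈ (q^≈ m))) (≈-sym ih₀))
                             (*-cong (+-congˡ (*-congʳ (q^≈ (suc m)))) (≈-sym ih₁)) ⟨
        b q U W X (suc m) ∎)

-- The ring of formal power series

open ≡-Reasoning

private
  variable
    N : ℕ
    A B C : Set

∑ : List A → (A → ℤ) → ℤ
∑ xs f = foldr ℤ._+_ 0ℤ (map f xs)

∑-cong : ∀ (xs : List A) {f g : A → ℤ} → (∀ x → f x ≡ g x) → ∑ xs f ≡ ∑ xs g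
∑-cong xs f≗g = cong (foldr ℤ._+_ 0ℤ) (Listₚ.map-cong f≗g xs)

∑-cong-∈ : ∀ (xs : List A) {f g : A → ℤ} → (∀ x → x ∈ xs → f x ≡ g x) → ∑ xs f ≡ ∑ xs g
∑-cong-∈ []       f≗g = refl
∑-cong-∈ (x ∷ xs) f≗g = cong₂ ℤ._+_ (f≗g x (here refl)) (∑-cong-∈ xs (λ y → f≗g y ∘ there))

∑-zero : ∀ (xs : List A) → ∑ xs (λ _ → 0ℤ) ≡ 0ℤ
∑-zero []       = refl
∑-zero (x ∷ xs) = trans (ℤₚ.+-identityˡ _) (∑-zero xs)

∑-+ : ∀ (xs : List A) (f g : A → ℤ) → ∑ xs (λ x → f x ℤ.+ g x) ≡ ∑ xs f ℤ.+ ∑ xs g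
∑-+ []       f g = refl
∑-+ (x ∷ xs) f g = trans (cong (λ s → (f x ℤ.+ g x) ℤ.+ s) (∑-+ xs f g))
  (solve 4 (λ a b c d → (a :+ b) :+ (c :+ d) := (a :+ c) :+ (b :+ d)) refl (f x) (g x) (∑ xs f) (∑ xs g))
  where open +-*-Solver

∑-++ : ∀ (xs ys : List A) (f : A → ℤ) → ∑ (xs List.++ ys) f ≡ ∑ xs f ℤ.+ ∑ ys f
∑-++ []       ys f = sym (ℤₚ.+-identityˡ _)
∑-++ (x ∷ xs) ys f = trans (cong (λ s → f x ℤ.+ s) (∑-++ xs ys f)) (sym (ℤₚ.+-assoc (f x) _ _))

∑-map : ∀ (xs : List A) (g : A → B) (f : B → ℤ) → ∑ (map g xs) f ≡ ∑ xs (f ∘ g)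
∑-map xs g f = cong (foldr ℤ._+_ 0ℤ) (sym (Listₚ.map-∘ xs))

∑-concatMap : ∀ (xs : List A) (g : A → List B) (f : B → ℤ) → ∑ (concatMap g xs) f ≡ ∑ xs (λ x → ∑ (g x) f)
∑-concatMap []       g f = refl
∑-concatMap (x ∷ xs) g f = trans (∑-++ (g x) (concatMap g xs) f) (cong (λ s → ∑ (g x) f ℤ.+ s) (∑-concatMap xs g f))

∑-upTo-suc : ∀ n (f : ℕ → ℤ) → ∑ (upTo (suc n)) f ≡ f 0 ℤ.+ ∑ (upTo n) (f ∘ suc)
∑-upTo-suc n f = cong (λ l → f 0 ℤ.+ foldr ℤ._+_ 0ℤ l)
  (trans (Listₚ.map-applyUpTo suc f n) (sym (Listₚ.map-applyUpTo id (f ∘ suc) n)))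

infix 4 _≐_
_≐_ : PS N → PS N → Set
f ≐ g = ∀ e → f e ≡ g e

0ₚ : PS N
0ₚ _ = 0ℤ

-- A series in N+1 variables is read as a series in the first variable over `PS N`; `tail f` is (f -
-- f₀)/x. The ring laws then follow by induction on the exponent of the first variable and on the
-- number of variables.
coeff : ℕ → PS (suc N) → PS N
coeff i f e = f (i ∷ e)

tail : PS (suc N) → PS (suc N)
tail f (i ∷ e) = f (suc i ∷ e)

⊗-curry : ∀ (f g : PS (suc N)) n e →
  (f ⊗ g) (n ∷ e) ≡ ∑ (upTo (suc n)) (λ i → (coeff i f ⊗ coeff (n ∸ i) g) e)
⊗-curry f g n e = trans
  (∑-concatMap (upTo (suc n)) (λ i → map (i ∷_) (below e)) _)
  (∑-cong (upTo (suc n)) (λ i → ∑-map (below e) (i ∷_) _))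

⊗-zero : ∀ (f g : PS (suc N)) e → (f ⊗ g) (0 ∷ e) ≡ (coeff 0 f ⊗ coeff 0 g) e
⊗-zero f g e = trans (⊗-curry f g 0 e) (ℤₚ.+-identityʳ _)

⊗-suc : ∀ (f g : PS (suc N)) n e →
  (f ⊗ g) (suc n ∷ e) ≡ (coeff 0 f ⊗ coeff (suc n) g) e ℤ.+ (tail f ⊗ g) (n ∷ e)
⊗-suc f g n e = trans (⊗-curry f g (suc n) e)
  (trans (∑-upTo-suc (suc n) (λ i → (coeff i f ⊗ coeff (suc n ∸ i) g) e)) (cong (λ s → (coeff 0 f ⊗ coeff (suc n) g) e ℤ.+ s) (sym (⊗-curry (tail f) g n e))))

⊗-cong : ∀ {f f′ g g′ : PS N} → f ≐ f′ → g ≐ g′ → f ⊗ g ≐ f′ ⊗ g′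
⊗-cong p q e = ∑-cong (below e) (λ d → cong₂ ℤ._*_ (p d) (q _))

⊗-distribˡ : ∀ (f g h : PS N) → f ⊗ (g ⊕ h) ≐ f ⊗ g ⊕ f ⊗ h
⊗-distribˡ f g h e = trans (∑-cong (below e) (λ d → ℤₚ.*-distribˡ-+ (f d) _ _)) (∑-+ (below e) _ _)

⊗-distribʳ : ∀ (f g h : PS N) → (g ⊕ h) ⊗ f ≐ g ⊗ f ⊕ h ⊗ f
⊗-distribʳ f g h e = trans (∑-cong (below e) (λ d → ℤₚ.*-distribʳ-+ _ (g d) (h d))) (∑-+ (below e) _ _)

⊗-zeroˡ : ∀ (f : PS N) → 0ₚ ⊗ f ≐ 0ₚ
⊗-zeroˡ f e = ∑-zero (below e)

-- Mirror image of `⊗-suc`, lowering the right factor instead of the left. Commutativity is the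
-- comparison of the two.
⊗-suc′ : ∀ (f g : PS (suc N)) n e →
  (f ⊗ g) (suc n ∷ e) ≡ (coeff (suc n) f ⊗ coeff 0 g) e ℤ.+ (f ⊗ tail g) (n ∷ e)
⊗-suc′ f g zero e = begin
  (f ⊗ g) (1 ∷ e)                           ≡⟨ ⊗-suc f g 0 e ⟩
  f₀g₁ ℤ.+ (tail f ⊗ g) (0 ∷ e)             ≡⟨ cong (λ s → f₀g₁ ℤ.+ s) (⊗-zero (tail f) g e) ⟩
  f₀g₁ ℤ.+ f₁g₀                             ≡⟨ ℤₚ.+-comm f₀g₁ f₁g₀ ⟩
  f₁g₀ ℤ.+ f₀g₁                             ≡⟨ cong (λ s → f₁g₀ ℤ.+ s) (⊗-zero f (tail g) e) ⟨
  f₁g₀ ℤ.+ (f ⊗ tail g) (0 ∷ e)             ∎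
  where
  f₀g₁ f₁g₀ : ℤ
  f₀g₁ = (coeff 0 f ⊗ coeff 1 g) e
  f₁g₀ = (coeff 1 f ⊗ coeff 0 g) e
⊗-suc′ f g (suc n) e = begin
  (f ⊗ g) (suc (suc n) ∷ e)                 ≡⟨ ⊗-suc f g (suc n) e ⟩
  u ℤ.+ (tail f ⊗ g) (suc n ∷ e)            ≡⟨ cong (λ s → u ℤ.+ s) (⊗-suc′ (tail f) g n e) ⟩
  u ℤ.+ (v ℤ.+ w)                           ≡⟨ solve 3 (λ u v w → u :+ (v :+ w) := v :+ (u :+ w)) refl u v w ⟩
  v ℤ.+ (u ℤ.+ w)                           ≡⟨ cong (λ s → v ℤ.+ s) (⊗-suc f (tail g) n e) ⟨
  v ℤ.+ (f ⊗ tail g) (suc n ∷ e)            ∎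
  where
  open +-*-Solver
  u v w : ℤ
  u = (coeff 0 f ⊗ coeff (suc (suc n)) g) e
  v = (coeff (suc (suc n)) f ⊗ coeff 0 g) e
  w = (tail f ⊗ tail g) (n ∷ e)

⊗-comm : ∀ (f g : PS N) → f ⊗ g ≐ g ⊗ f
⊗-comm f g []          = cong (ℤ._+ 0ℤ) (ℤₚ.*-comm (f []) (g []))
⊗-comm f g (zero ∷ e)  = begin
  (f ⊗ g) (0 ∷ e)              ≡⟨ ⊗-zero f g e ⟩
  (coeff 0 f ⊗ coeff 0 g) e    ≡⟨ ⊗-comm (coeff 0 f) (coeff 0 g) e ⟩
  (coeff 0 g ⊗ coeff 0 f) e    ≡⟨ ⊗-zero g f e ⟨
  (g ⊗ f) (0 ∷ e)              ∎
⊗-comm f g (suc n ∷ e) = begin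
  (f ⊗ g) (suc n ∷ e)                                        ≡⟨ ⊗-suc f g n e ⟩
  (coeff 0 f ⊗ coeff (suc n) g) e ℤ.+ (tail f ⊗ g) (n ∷ e)
    ≡⟨ cong₂ ℤ._+_ (⊗-comm (coeff 0 f) (coeff (suc n) g) e) (⊗-comm (tail f) g (n ∷ e)) ⟩
  (coeff (suc n) g ⊗ coeff 0 f) e ℤ.+ (g ⊗ tail f) (n ∷ e)   ≡⟨ ⊗-suc′ g f n e ⟨
  (g ⊗ f) (suc n ∷ e)                                        ∎

infixl 7 _⋆_
-- Scalar multiplication by a coefficient. It arises in the proof of associativity because
-- `tail (f ⊗ g)` is `coeff 0 f ⋆ tail g ⊕ tail f ⊗ g`, so `⋆-assoc` and `⊗-assoc` have to be proved
-- together.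
_⋆_ : PS N → PS (suc N) → PS (suc N)
(c ⋆ f) (i ∷ e) = (c ⊗ coeff i f) e

mutual
  ⋆-assoc : ∀ (c : PS N) (f g : PS (suc N)) n e → ((c ⋆ f) ⊗ g) (n ∷ e) ≡ (c ⊗ coeff n (f ⊗ g)) e
  ⋆-assoc c f g zero e = begin
    ((c ⋆ f) ⊗ g) (0 ∷ e)                ≡⟨ ⊗-zero (c ⋆ f) g e ⟩
    ((c ⊗ coeff 0 f) ⊗ coeff 0 g) e      ≡⟨ ⊗-assoc c (coeff 0 f) (coeff 0 g) e ⟩
    (c ⊗ (coeff 0 f ⊗ coeff 0 g)) e      ≡⟨ ⊗-cong {f = c} (λ _ → refl) (λ e → sym (⊗-zero f g e)) e ⟩
    (c ⊗ coeff 0 (f ⊗ g)) e              ∎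
  ⋆-assoc c f g (suc n) e = begin
    ((c ⋆ f) ⊗ g) (suc n ∷ e)
      ≡⟨ ⊗-suc (c ⋆ f) g n e ⟩
    ((c ⊗ coeff 0 f) ⊗ coeff (suc n) g) e ℤ.+ (tail (c ⋆ f) ⊗ g) (n ∷ e)
      ≡⟨ cong₂ ℤ._+_ (⊗-assoc c (coeff 0 f) (coeff (suc n) g) e)
           (trans (⊗-cong {f = tail (c ⋆ f)} {c ⋆ tail f} {g} (λ { (_ ∷ _) → refl }) (λ _ → refl) (n ∷ e)) (⋆-assoc c (tail f) g n e)) ⟩
    (c ⊗ (coeff 0 f ⊗ coeff (suc n) g)) e ℤ.+ (c ⊗ coeff n (tail f ⊗ g)) e
      ≡⟨ ⊗-distribˡ c (coeff 0 f ⊗ coeff (suc n) g) (coeff n (tail f ⊗ g)) e ⟨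
    (c ⊗ (coeff 0 f ⊗ coeff (suc n) g ⊕ coeff n (tail f ⊗ g))) e
      ≡⟨ ⊗-cong {f = c} (λ _ → refl) (λ e → sym (⊗-suc f g n e)) e ⟩
    (c ⊗ coeff (suc n) (f ⊗ g)) e ∎

  ⊗-assoc : ∀ (f g h : PS N) → (f ⊗ g) ⊗ h ≐ f ⊗ (g ⊗ h)
  ⊗-assoc f g h [] = solve 3 (λ f g h → (f :* g :+ con 0ℤ) :* h :+ con 0ℤ := f :* (g :* h :+ con 0ℤ) :+ con 0ℤ)
    refl (f []) (g []) (h [])
    where open +-*-Solver
  ⊗-assoc f g h (zero ∷ e) = begin
    ((f ⊗ g) ⊗ h) (0 ∷ e)                       ≡⟨ ⊗-zero (f ⊗ g) h e ⟩
    (coeff 0 (f ⊗ g) ⊗ coeff 0 h) e             ≡⟨ ⊗-cong {g = coeff 0 h} (⊗-zero f g) (λ _ → refl) e ⟩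
    ((coeff 0 f ⊗ coeff 0 g) ⊗ coeff 0 h) e     ≡⟨ ⋆-assoc-zero ⟩
    (coeff 0 f ⊗ coeff 0 (g ⊗ h)) e             ≡⟨ ⊗-zero f (g ⊗ h) e ⟨
    (f ⊗ (g ⊗ h)) (0 ∷ e)                       ∎
    where
    ⋆-assoc-zero : ((coeff 0 f ⊗ coeff 0 g) ⊗ coeff 0 h) e ≡ (coeff 0 f ⊗ coeff 0 (g ⊗ h)) e
    ⋆-assoc-zero = trans (⊗-assoc (coeff 0 f) (coeff 0 g) (coeff 0 h) e)
      (⊗-cong {f = coeff 0 f} (λ _ → refl) (λ e → sym (⊗-zero g h e)) e)
  ⊗-assoc f g h (suc n ∷ e) = begin
    ((f ⊗ g) ⊗ h) (suc n ∷ e)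
      ≡⟨ ⊗-suc (f ⊗ g) h n e ⟩
    (coeff 0 (f ⊗ g) ⊗ hₙ) e ℤ.+ (tail (f ⊗ g) ⊗ h) (n ∷ e)
      ≡⟨ cong₂ ℤ._+_ (⊗-cong {g = hₙ} (⊗-zero f g) (λ _ → refl) e)
           (⊗-cong {f = tail (f ⊗ g)} {f₀ ⋆ tail g ⊕ tail f ⊗ g} {h} (λ { (i ∷ e) → ⊗-suc f g i e }) (λ _ → refl) (n ∷ e)) ⟩
    ((f₀ ⊗ g₀) ⊗ hₙ) e ℤ.+ ((f₀ ⋆ tail g ⊕ tail f ⊗ g) ⊗ h) (n ∷ e)
      ≡⟨ cong₂ ℤ._+_ (⊗-assoc f₀ g₀ hₙ e) (⊗-distribʳ h (f₀ ⋆ tail g) (tail f ⊗ g) (n ∷ e)) ⟩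
    (f₀ ⊗ (g₀ ⊗ hₙ)) e ℤ.+ (((f₀ ⋆ tail g) ⊗ h) (n ∷ e) ℤ.+ ((tail f ⊗ g) ⊗ h) (n ∷ e))
      ≡⟨ cong (λ z → (f₀ ⊗ (g₀ ⊗ hₙ)) e ℤ.+ z)
           (cong₂ ℤ._+_ (⋆-assoc f₀ (tail g) h n e) (⊗-assoc (tail f) g h (n ∷ e))) ⟩
    (f₀ ⊗ (g₀ ⊗ hₙ)) e ℤ.+ ((f₀ ⊗ coeff n (tail g ⊗ h)) e ℤ.+ (tail f ⊗ (g ⊗ h)) (n ∷ e))
      ≡⟨ ℤₚ.+-assoc ((f₀ ⊗ (g₀ ⊗ hₙ)) e) _ _ ⟨
    (f₀ ⊗ (g₀ ⊗ hₙ)) e ℤ.+ (f₀ ⊗ coeff n (tail g ⊗ h)) e ℤ.+ (tail f ⊗ (g ⊗ h)) (n ∷ e)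
      ≡⟨ cong (λ s → s ℤ.+ (tail f ⊗ (g ⊗ h)) (n ∷ e)) (⊗-distribˡ f₀ (g₀ ⊗ hₙ) (coeff n (tail g ⊗ h)) e) ⟨
    (f₀ ⊗ (g₀ ⊗ hₙ ⊕ coeff n (tail g ⊗ h))) e ℤ.+ (tail f ⊗ (g ⊗ h)) (n ∷ e)
      ≡⟨ cong (λ s → s ℤ.+ (tail f ⊗ (g ⊗ h)) (n ∷ e))
           (⊗-cong {f = f₀} (λ _ → refl) (λ e → sym (⊗-suc g h n e)) e) ⟩
    (f₀ ⊗ coeff (suc n) (g ⊗ h)) e ℤ.+ (tail f ⊗ (g ⊗ h)) (n ∷ e)
      ≡⟨ ⊗-suc f (g ⊗ h) n e ⟨
    (f ⊗ (g ⊗ h)) (suc n ∷ e) ∎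
    where
    f₀ g₀ hₙ : PS _
    f₀ = coeff 0 f
    g₀ = coeff 0 g
    hₙ = coeff (suc n) h

-- Monomials and the commutative ring structure

mono-≡ : ∀ {a e : Vec ℕ N} → a ≡ e → mono a e ≡ 1ℤ
mono-≡ {a = a} {e} p rewrite dec-true (Vecₚ.≡-dec ℕ._≟_ a e) p = refl

mono-≢ : ∀ {a e : Vec ℕ N} → a ≢ e → mono a e ≡ 0ℤ
mono-≢ {a = a} {e} p rewrite dec-false (Vecₚ.≡-dec ℕ._≟_ a e) p = refl

mono-∷-≡ : ∀ n (a : Vec ℕ N) → coeff n (mono (n ∷ a)) ≐ mono a
mono-∷-≡ n a e = helper (Vecₚ.≡-dec ℕ._≟_ a e)
  where
  helper : Dec (a ≡ e) → mono (n ∷ a) (n ∷ e) ≡ mono a e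
  helper (yes p) = trans (mono-≡ {a = n ∷ a} (cong (n ∷_) p)) (sym (mono-≡ p))
  helper (no ¬p) = trans (mono-≢ {a = n ∷ a} (¬p ∘ proj₂ ∘ Vecₚ.∷-injective)) (sym (mono-≢ ¬p))

mono-∷-≢ : ∀ {m n} (a : Vec ℕ N) → m ≢ n → coeff n (mono (m ∷ a)) ≐ 0ₚ
mono-∷-≢ {m = m} {n} a m≢n e = mono-≢ {a = m ∷ a} {n ∷ e} (m≢n ∘ proj₁ ∘ Vecₚ.∷-injective)

tail-mono-zero : ∀ (a : Vec ℕ N) → tail (mono (0 ∷ a)) ≐ 0ₚ
tail-mono-zero a (i ∷ e) = mono-∷-≢ {m = 0} {suc i} a (λ ()) e

tail-mono-suc : ∀ m (a : Vec ℕ N) → tail (mono (suc m ∷ a)) ≐ mono (m ∷ a)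
tail-mono-suc m a (i ∷ e) = helper (m ℕ.≟ i)
  where
  helper : Dec (m ≡ i) → mono (suc m ∷ a) (suc i ∷ e) ≡ mono (m ∷ a) (i ∷ e)
  helper (yes refl) = trans (mono-∷-≡ (suc m) a e) (sym (mono-∷-≡ m a e))
  helper (no m≢i)   = trans (mono-∷-≢ a (m≢i ∘ ℕₚ.suc-injective) e) (sym (mono-∷-≢ a m≢i e))

mono-zero-⊗ : ∀ (a : Vec ℕ N) (g : PS (suc N)) n e → (mono (0 ∷ a) ⊗ g) (n ∷ e) ≡ (mono a ⊗ coeff n g) e
mono-zero-⊗ a g zero e = trans (⊗-zero (mono (0 ∷ a)) g e)
  (⊗-cong {g = coeff 0 g} (mono-∷-≡ 0 a) (λ _ → refl) e)
mono-zero-⊗ a g (suc n) e = begin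
  (mono (0 ∷ a) ⊗ g) (suc n ∷ e)
    ≡⟨ ⊗-suc (mono (0 ∷ a)) g n e ⟩
  (coeff 0 (mono (0 ∷ a)) ⊗ coeff (suc n) g) e ℤ.+ (tail (mono (0 ∷ a)) ⊗ g) (n ∷ e)
    ≡⟨ cong₂ ℤ._+_ (⊗-cong {g = coeff (suc n) g} (mono-∷-≡ 0 a) (λ _ → refl) e)
         (trans (⊗-cong {g = g} (tail-mono-zero a) (λ _ → refl) (n ∷ e)) (⊗-zeroˡ g (n ∷ e))) ⟩
  (mono a ⊗ coeff (suc n) g) e ℤ.+ 0ℤ
    ≡⟨ ℤₚ.+-identityʳ _ ⟩
  (mono a ⊗ coeff (suc n) g) e ∎

⊗-identityˡ : ∀ (f : PS N) → one ⊗ f ≐ f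
⊗-identityˡ f []      = trans (ℤₚ.+-identityʳ _) (ℤₚ.*-identityˡ (f []))
⊗-identityˡ f (n ∷ e) = trans (mono-zero-⊗ (replicate _ 0) f n e) (⊗-identityˡ (coeff n f) e)

mono-+ : ∀ (a b : Vec ℕ N) → mono (zipWith ℕ._+_ a b) ≐ mono a ⊗ mono b
mono-+ [] [] [] = refl
mono-+ (zero ∷ a) (m ∷ b) (n ∷ e) = trans (helper (m ℕ.≟ n)) (sym (mono-zero-⊗ a (mono (m ∷ b)) n e))
  where
  helper : Dec (m ≡ n) → mono (m ∷ zipWith ℕ._+_ a b) (n ∷ e) ≡ (mono a ⊗ coeff n (mono (m ∷ b))) e
  helper (yes refl) = begin
    mono (n ∷ zipWith ℕ._+_ a b) (n ∷ e)    ≡⟨ mono-∷-≡ n (zipWith ℕ._+_ a b) e ⟩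
    mono (zipWith ℕ._+_ a b) e              ≡⟨ mono-+ a b e ⟩
    (mono a ⊗ mono b) e                     ≡⟨ ⊗-cong {f = mono a} (λ _ → refl) (λ e → sym (mono-∷-≡ n b e)) e ⟩
    (mono a ⊗ coeff n (mono (n ∷ b))) e     ∎
  helper (no m≢n) = begin
    mono (m ∷ zipWith ℕ._+_ a b) (n ∷ e)    ≡⟨ mono-∷-≢ (zipWith ℕ._+_ a b) m≢n e ⟩
    0ℤ                                      ≡⟨ ⊗-zeroˡ (mono a) e ⟨
    (0ₚ ⊗ mono a) e                         ≡⟨ ⊗-comm 0ₚ (mono a) e ⟩
    (mono a ⊗ 0ₚ) e                         ≡⟨ ⊗-cong {f = mono a} (λ _ → refl) (λ e → sym (mono-∷-≢ b m≢n e)) e ⟩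
    (mono a ⊗ coeff n (mono (m ∷ b))) e     ∎
mono-+ (suc k ∷ a) (m ∷ b) (zero ∷ e) = begin
  mono (suc (k ℕ.+ m) ∷ zipWith ℕ._+_ a b) (0 ∷ e)  ≡⟨ mono-∷-≢ {m = suc (k ℕ.+ m)} {0} (zipWith ℕ._+_ a b) (λ ()) e ⟩
  0ℤ                                                ≡⟨ ⊗-zeroˡ (coeff 0 (mono (m ∷ b))) e ⟨
  (0ₚ ⊗ coeff 0 (mono (m ∷ b))) e
    ≡⟨ ⊗-cong {g = coeff 0 (mono (m ∷ b))} (λ e → sym (mono-∷-≢ {m = suc k} {0} a (λ ()) e)) (λ _ → refl) e ⟩
  (coeff 0 (mono (suc k ∷ a)) ⊗ coeff 0 (mono (m ∷ b))) e  ≡⟨ ⊗-zero (mono (suc k ∷ a)) (mono (m ∷ b)) e ⟨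
  (mono (suc k ∷ a) ⊗ mono (m ∷ b)) (0 ∷ e)         ∎
mono-+ (suc k ∷ a) (m ∷ b) (suc n ∷ e) = begin
  mono (suc (k ℕ.+ m) ∷ zipWith ℕ._+_ a b) (suc n ∷ e)
    ≡⟨ tail-mono-suc (k ℕ.+ m) (zipWith ℕ._+_ a b) (n ∷ e) ⟩
  mono (zipWith ℕ._+_ (k ∷ a) (m ∷ b)) (n ∷ e)
    ≡⟨ mono-+ (k ∷ a) (m ∷ b) (n ∷ e) ⟩
  (mono (k ∷ a) ⊗ g) (n ∷ e)
    ≡⟨ ⊗-cong {f = mono (k ∷ a)} {tail (mono (suc k ∷ a))} {g} (λ e → sym (tail-mono-suc k a e)) (λ _ → refl) (n ∷ e) ⟩
  (tail (mono (suc k ∷ a)) ⊗ g) (n ∷ e)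
    ≡⟨ ℤₚ.+-identityˡ _ ⟨
  0ℤ ℤ.+ (tail (mono (suc k ∷ a)) ⊗ g) (n ∷ e)
    ≡⟨ cong (λ s → s ℤ.+ (tail (mono (suc k ∷ a)) ⊗ g) (n ∷ e)) (⊗-zeroˡ (coeff (suc n) g) e) ⟨
  (0ₚ ⊗ coeff (suc n) g) e ℤ.+ (tail (mono (suc k ∷ a)) ⊗ g) (n ∷ e)
    ≡⟨ cong (λ s → s ℤ.+ (tail (mono (suc k ∷ a)) ⊗ g) (n ∷ e))
         (⊗-cong {g = coeff (suc n) g} (λ e → sym (mono-∷-≢ {m = suc k} {0} a (λ ()) e)) (λ _ → refl) e) ⟩
  (coeff 0 (mono (suc k ∷ a)) ⊗ coeff (suc n) g) e ℤ.+ (tail (mono (suc k ∷ a)) ⊗ g) (n ∷ e)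
    ≡⟨ ⊗-suc (mono (suc k ∷ a)) g n e ⟨
  (mono (suc k ∷ a) ⊗ g) (suc n ∷ e) ∎
  where
  g : PS _
  g = mono (m ∷ b)

PS-commutativeRing : ℕ → CommutativeRing _ _
PS-commutativeRing N = record
  { Carrier = PS N
  ; _≈_     = _≐_
  ; _+_     = _⊕_
  ; _*_     = _⊗_
  ; -_      = ⊝_
  ; 0#      = 0ₚ
  ; 1#      = one
  ; isCommutativeRing = record
    { isRing = record
      { +-isAbelianGroup = record
        { isGroup = record
          { isMonoid = record
            { isSemigroup = record
              { isMagma = record
                { isEquivalence = record
                  { refl  = λ _ → refl
                  ; sym   = λ p e → sym (p e)
                  ; trans = λ p q e → trans (p e) (q e)
                  }
                ; ∙-cong = λ p q e → cong₂ ℤ._+_ (p e) (q e)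
                }
              ; assoc = λ f g h e → ℤₚ.+-assoc (f e) (g e) (h e)
              }
            ; identity = (λ f e → ℤₚ.+-identityˡ (f e)) , (λ f e → ℤₚ.+-identityʳ (f e))
            }
          ; inverse = (λ f e → ℤₚ.+-inverseˡ (f e)) , (λ f e → ℤₚ.+-inverseʳ (f e))
          ; ⁻¹-cong = λ p e → cong ℤ.-_ (p e)
          }
        ; comm = λ f g e → ℤₚ.+-comm (f e) (g e)
        }
      ; *-cong     = ⊗-cong
      ; *-assoc    = ⊗-assoc
      ; *-identity = ⊗-identityˡ , λ f e → trans (⊗-comm f one e) (⊗-identityˡ f e)
      ; distrib    = ⊗-distribˡ , ⊗-distribʳ
      }
    ; *-comm = ⊗-comm
    }
  }

-- Inverses of series with constant term 1

∈-below⇒sum-∸ : ∀ (e : Vec ℕ N) {d} → d ∈ below e → Vec.sum (zipWith _∸_ e d) ℕ.+ Vec.sum d ≡ Vec.sum e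
∈-below⇒sum-∸ []      (here refl) = refl
∈-below⇒sum-∸ (n ∷ e) d∈ with find (∈-concatMap⁻ (λ i → map (i ∷_) (below e)) {xs = upTo (suc n)} d∈)
... | i , i∈ , p with ∈-map⁻ (i ∷_) p
... | d , d∈e , refl = begin
  (n ∸ i ℕ.+ s) ℕ.+ (i ℕ.+ t)   ≡⟨ solve 4 (λ a s i t → (a :+ s) :+ (i :+ t) := (a :+ i) :+ (s :+ t)) refl (n ∸ i) s i t ⟩
  (n ∸ i ℕ.+ i) ℕ.+ (s ℕ.+ t)   ≡⟨ cong₂ ℕ._+_ (ℕₚ.m∸n+n≡m (ℕ.s≤s⁻¹ (∈-upTo⁻ i∈))) (∈-below⇒sum-∸ e d∈e) ⟩
  n ℕ.+ Vec.sum e               ∎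
  where
  open ℕSolver.+-*-Solver
  s t : ℕ
  s = Vec.sum (zipWith _∸_ e d)
  t = Vec.sum d

sum-zeroV : ∀ N → Vec.sum (zeroV {N}) ≡ 0
sum-zeroV zero    = refl
sum-zeroV (suc N) = sum-zeroV N

sum≡0⇒≡zeroV : ∀ (e : Vec ℕ N) → Vec.sum e ≡ 0 → e ≡ zeroV
sum≡0⇒≡zeroV []         _ = refl
sum≡0⇒≡zeroV (zero ∷ e) p = cong (0 ∷_) (sum≡0⇒≡zeroV e p)

module Inverse {N : ℕ} (f : PS N) (f-zeroV≡1 : f zeroV ≡ 1ℤ) where

  -- The summand in the recursion of `invAux`, with the recursive values abstracted to `g` so that
  -- different amounts of fuel can be compared.
  properTerm : (Vec ℕ N → ℤ) → Vec ℕ N → Vec ℕ N → ℤ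
  properTerm g e d = if does (Vecₚ.≡-dec ℕ._≟_ d zeroV) then 0ℤ else f d ℤ.* g (zipWith _∸_ e d)

  properTerm-zeroV : ∀ g e {d} → d ≡ zeroV → properTerm g e d ≡ 0ℤ
  properTerm-zeroV g e {d} p rewrite dec-true (Vecₚ.≡-dec ℕ._≟_ d zeroV) p = refl

  properTerm-≢ : ∀ g e {d} → d ≢ zeroV → properTerm g e d ≡ f d ℤ.* g (zipWith _∸_ e d)
  properTerm-≢ g e {d} p rewrite dec-false (Vecₚ.≡-dec ℕ._≟_ d zeroV) p = refl

  properTerm-cong : ∀ {g h : Vec ℕ N → ℤ} e → (∀ e′ → Vec.sum e′ < Vec.sum e → g e′ ≡ h e′) →
    ∀ d → d ∈ below e → properTerm g e d ≡ properTerm h e d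
  properTerm-cong {g} {h} e g≗h d d∈ = helper (Vecₚ.≡-dec ℕ._≟_ d zeroV)
    where
    helper : Dec (d ≡ zeroV) → properTerm g e d ≡ properTerm h e d
    helper (yes p) = trans (properTerm-zeroV g e p) (sym (properTerm-zeroV h e p))
    helper (no ¬p) = trans (properTerm-≢ g e ¬p) (trans
      (cong (f d ℤ.*_) (g≗h _ smaller)) (sym (properTerm-≢ h e ¬p)))
      where
      smaller : Vec.sum (zipWith _∸_ e d) < Vec.sum e
      smaller = subst (Vec.sum (zipWith _∸_ e d) <_) (∈-below⇒sum-∸ e d∈)
        (ℕₚ.m<m+n _ (ℕₚ.n≢0⇒n>0 (¬p ∘ sum≡0⇒≡zeroV d)))

  invAux-zeroV : ∀ n {e} → e ≡ zeroV → invAux f n e ≡ 1ℤ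
  invAux-zeroV zero    p = mono-≡ (sym p)
  invAux-zeroV (suc n) {e} p rewrite dec-true (Vecₚ.≡-dec ℕ._≟_ e zeroV) p = refl

  invAux-≢ : ∀ n {e} → e ≢ zeroV → invAux f (suc n) e ≡ ℤ.- ∑ (below e) (properTerm (invAux f n) e)
  invAux-≢ n {e} p rewrite dec-false (Vecₚ.≡-dec ℕ._≟_ e zeroV) p = refl

  -- A proper term evaluates the inverse only at e - d with d nonzero, where the total degree is
  -- strictly smaller; one unit of fuel less is enough there.
  invAux-stable : ∀ n e → Vec.sum e ≤ n → invAux f (suc n) e ≡ invAux f n e
  invAux-stable n e ≤n = helper n ≤n (Vecₚ.≡-dec ℕ._≟_ e zeroV)
    where
    helper : ∀ n → Vec.sum e ≤ n → Dec (e ≡ zeroV) → invAux f (suc n) e ≡ invAux f n e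
    helper n ≤n (yes p) = trans (invAux-zeroV (suc n) p) (sym (invAux-zeroV n p))
    helper zero ≤n (no ¬p) = contradiction (sum≡0⇒≡zeroV e (ℕₚ.n≤0⇒n≡0 ≤n)) ¬p
    helper (suc n) ≤n (no ¬p) = trans (invAux-≢ (suc n) ¬p) (trans
      (cong ℤ.-_ (∑-cong-∈ (below e) (properTerm-cong e
        (λ e′ e′<e → invAux-stable n e′ (ℕ.s≤s⁻¹ (ℕₚ.≤-trans e′<e ≤n))))))
      (sym (invAux-≢ n ¬p)))

  invAux≡inv : ∀ n e → Vec.sum e ≤ n → invAux f n e ≡ inv f e
  invAux≡inv n e ≤n = helper (ℕₚ.≤⇒≤′ ≤n)
    where
    helper : ∀ {n} → Vec.sum e ℕ.≤′ n → invAux f n e ≡ inv f e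
    helper (ℕ.≤′-reflexive refl) = refl
    helper (ℕ.≤′-step p)         = trans (invAux-stable _ e (ℕₚ.≤′⇒≤ p)) (helper p)

  -- `inv f` runs with different fuel at e and at each e - d. By stability all these values can be
  -- taken with a common fuel, and so the recursion holds for `inv f` itself.
  inv-≢ : ∀ {e} → e ≢ zeroV → inv f e ≡ ℤ.- ∑ (below e) (properTerm (inv f) e)
  inv-≢ {e} ¬p = trans (sym (invAux≡inv (suc (Vec.sum e)) e (ℕₚ.n≤1+n _)))
    (trans (invAux-≢ (Vec.sum e) ¬p) (cong ℤ.-_ (∑-cong-∈ (below e) (properTerm-cong e
      (λ e′ e′<e → invAux≡inv (Vec.sum e) e′ (ℕₚ.<⇒≤ e′<e))))))

  term-split : ∀ (g : PS N) e d → f d ℤ.* g (zipWith _∸_ e d)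
    ≡ one d ℤ.* g (zipWith _∸_ e d) ℤ.+ properTerm g e d
  term-split g e d = helper (Vecₚ.≡-dec ℕ._≟_ d zeroV)
    where
    y : ℤ
    y = g (zipWith _∸_ e d)
    helper : Dec (d ≡ zeroV) → f d ℤ.* y ≡ one d ℤ.* y ℤ.+ properTerm g e d
    helper (yes p) = trans (cong (ℤ._* y) (trans (trans (cong f p) f-zeroV≡1) (sym (mono-≡ (sym p)))))
      (trans (sym (ℤₚ.+-identityʳ _)) (cong (λ s → one d ℤ.* y ℤ.+ s) (sym (properTerm-zeroV g e p))))
    helper (no ¬p) = trans (sym (ℤₚ.+-identityˡ _))
      (cong₂ ℤ._+_ (cong (ℤ._* y) (sym (mono-≢ {a = zeroV} (¬p ∘ sym)))) (sym (properTerm-≢ g e ¬p)))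

  ⊗-inverseʳ : f ⊗ inv f ≐ one
  ⊗-inverseʳ e = begin
    ∑ (below e) (λ d → f d ℤ.* inv f (zipWith _∸_ e d))
      ≡⟨ ∑-cong (below e) (term-split (inv f) e) ⟩
    ∑ (below e) (λ d → one d ℤ.* inv f (zipWith _∸_ e d) ℤ.+ properTerm (inv f) e d)
      ≡⟨ ∑-+ (below e) (λ d → one d ℤ.* inv f (zipWith _∸_ e d)) (properTerm (inv f) e) ⟩
    (one ⊗ inv f) e ℤ.+ S
      ≡⟨ cong (λ s → s ℤ.+ S) (⊗-identityˡ (inv f) e) ⟩
    inv f e ℤ.+ S
      ≡⟨ helper (Vecₚ.≡-dec ℕ._≟_ e zeroV) ⟩
    one e ∎
    where
    S : ℤ
    S = ∑ (below e) (properTerm (inv f) e)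
    helper : Dec (e ≡ zeroV) → inv f e ℤ.+ S ≡ one e
    helper (yes p) = trans (cong₂ ℤ._+_ (invAux-zeroV (Vec.sum e) p) S≡0) (sym (mono-≡ (sym p)))
      where
      S≡0 : S ≡ 0ℤ
      S≡0 = trans (∑-cong-∈ (below e) (λ d d∈ → properTerm-zeroV (inv f) e (sum≡0⇒≡zeroV d
        (ℕₚ.m+n≡0⇒n≡0 _ (trans (∈-below⇒sum-∸ e d∈) (trans (cong Vec.sum p) (sum-zeroV N)))))))
        (∑-zero (below e))
    helper (no ¬p) = trans (cong (λ s → s ℤ.+ S) (inv-≢ ¬p))
      (trans (ℤₚ.+-inverseˡ S) (sym (mono-≢ {a = zeroV} (¬p ∘ sym))))

prodTo≡∏ : ∀ {F G : ℕ → PS N} → (∀ i → F i ≡ G i) → ∀ n →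
  prodTo F n ≡ Recurrence.∏ (PS-commutativeRing N) G n
prodTo≡∏ F≗G zero    = refl
prodTo≡∏ F≗G (suc n) = cong₂ _⊗_ (prodTo≡∏ F≗G n) (F≗G (suc n))

⊗^≡^ : ∀ (q : PS N) n → q ⊗^ n ≡ Recurrence._^_ (PS-commutativeRing N) q n
⊗^≡^ q zero    = refl
⊗^≡^ q (suc n) = cong (q ⊗_) (⊗^≡^ q n)

-- The x-adic filtration

Order≥ : ℕ → PS (suc N) → Set
Order≥ n f = ∀ i e → i < n → f (i ∷ e) ≡ 0ℤ

⊗≡0ˡ : ∀ (f g : PS N) → f ≐ 0ₚ → f ⊗ g ≐ 0ₚ
⊗≡0ˡ f g p e = trans (⊗-cong {f = f} {0ₚ} {g} p (λ _ → refl) e) (⊗-zeroˡ g e)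

⊗≡0ʳ : ∀ (f g : PS N) → g ≐ 0ₚ → f ⊗ g ≐ 0ₚ
⊗≡0ʳ f g p e = trans (⊗-comm f g e) (⊗≡0ˡ g f p e)

Order≥-⊗ʳ : ∀ {n} (f g : PS (suc N)) → Order≥ n g → Order≥ n (f ⊗ g)
Order≥-⊗ʳ f g p zero e i<n = trans (⊗-zero f g e) (⊗≡0ʳ (coeff 0 f) (coeff 0 g) (λ e → p 0 e i<n) e)
Order≥-⊗ʳ f g p (suc i) e i<n = trans (⊗-suc f g i e)
  (cong₂ ℤ._+_ (⊗≡0ʳ (coeff 0 f) (coeff (suc i) g) (λ e → p (suc i) e i<n) e)
    (Order≥-⊗ʳ (tail f) g p i e (ℕₚ.<-trans (ℕₚ.n<1+n i) i<n)))

-- If f has positive order then its constant coefficient in x vanishes, and f ⊗ g is x times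
-- `tail f ⊗ g`, where `tail f` has order one less.
Order≥-⊗ : ∀ {m n} (f g : PS (suc N)) → Order≥ m f → Order≥ n g → Order≥ (m ℕ.+ n) (f ⊗ g)
Order≥-⊗ {m = zero}  f g p q = Order≥-⊗ʳ f g q
Order≥-⊗ {m = suc m} f g p q zero e i< =
  trans (⊗-zero f g e) (⊗≡0ˡ (coeff 0 f) (coeff 0 g) (λ e → p 0 e (s≤s z≤n)) e)
Order≥-⊗ {m = suc m} f g p q (suc i) e i< = trans (⊗-suc f g i e)
  (cong₂ ℤ._+_ (⊗≡0ˡ (coeff 0 f) (coeff (suc i) g) (λ e → p 0 e (s≤s z≤n)) e)
    (Order≥-⊗ {m = m} (tail f) g (λ i e i<m → p (suc i) e (s≤s i<m)) q i e (ℕ.s≤s⁻¹ i<)))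

Order≥-mono : ∀ m (a : Vec ℕ N) → Order≥ m (mono (m ∷ a))
Order≥-mono m a i e i<m = mono-∷-≢ a (ℕₚ.>⇒≢ i<m) e

Order≥-sumL : ∀ {n} (xs : List A) (f : A → PS (suc N)) → (∀ x → Order≥ n (f x)) → Order≥ n (sumL xs f)
Order≥-sumL []       f p i e i<n = refl
Order≥-sumL (x ∷ xs) f p i e i<n = cong₂ ℤ._+_ (p x i e i<n) (Order≥-sumL xs f p i e i<n)

isFiltration : Recurrence.IsFiltration (PS-commutativeRing (suc N)) Order≥
isFiltration = record
  { resp = λ x≐y p i e i<n → trans (sym (x≐y (i ∷ e))) (p i e i<n)
  ; anti = λ m≤n p i e i<m → p i e (ℕₚ.<-≤-trans i<m m≤n)
  ; I-0  = λ i e i<n → refl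
  ; I₀   = λ i e ()
  ; I-+  = λ p q i e i<n → cong₂ ℤ._+_ (p i e i<n) (q i e i<n)
  ; I-*  = λ {m} {n} {f} {g} → Order≥-⊗ f g
  }

-- Infinite products as x-adic limits

module PochhammerLimit {N : ℕ} where

  private
    R : CommutativeRing _ _
    R = PS-commutativeRing (suc N)

  open Recurrence R
  open CommutativeRing R using (*-identityʳ)
  open IsFiltration (isFiltration {N}) using (_≈[_]_; ≈⇒≈[]; ≈[]-sym; ≈[]-trans; ≈[]-*ˡ)

  -- The coefficients at x^i are read off from the i-th term, the diagonal also used by `infProd`:
  -- `infProd F` is `lim (prodTo F)`.
  lim : (ℕ → PS (suc N)) → PS (suc N)
  lim s e = s (head0 e) e

  ≈[]⇒≡ : ∀ {n} {f g : PS (suc N)} → f ≈[ n ] g → ∀ i e → i < n → f (i ∷ e) ≡ g (i ∷ e)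
  ≈[]⇒≡ p i e i<n = ℤₚ.i-j≡0⇒i≡j _ _ (p i e i<n)

  ≡⇒≈[] : ∀ {n} {f g : PS (suc N)} → (∀ i e → i < n → f (i ∷ e) ≡ g (i ∷ e)) → f ≈[ n ] g
  ≡⇒≈[] p i e i<n = ℤₚ.i≡j⇒i-j≡0 (p i e i<n)

  ≈[]-*ʳ : ∀ {n} {f g : PS (suc N)} h → f ≈[ n ] g → f ⊗ h ≈[ n ] g ⊗ h
  ≈[]-*ʳ {n} {f} {g} h p = ≈[]-trans {n} {f ⊗ h} {h ⊗ f} {g ⊗ h} (≈⇒≈[] {n} {f ⊗ h} {h ⊗ f} (⊗-comm f h))
    (≈[]-trans {n} {h ⊗ f} {h ⊗ g} {g ⊗ h} (≈[]-*ˡ {n} {f} {g} h p) (≈⇒≈[] {n} {h ⊗ g} {g ⊗ h} (⊗-comm h g)))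

  -- For j ≥ i, passing from the j-th term to the next changes only coefficients of x-exponent above
  -- j, so the coefficients at x^i are frozen from index i on.
  lim≈ : ∀ {s : ℕ → PS (suc N)} → (∀ j → s (suc j) ≈[ suc j ] s j) → ∀ n → lim s ≈[ suc n ] s n
  lim≈ {s} stable n = ≡⇒≈[] {suc n} {lim s} {s n} (λ i e i≤n → helper i e (ℕₚ.≤⇒≤′ (ℕ.s≤s⁻¹ i≤n)))
    where
    helper : ∀ {n} i e → i ℕ.≤′ n → s i (i ∷ e) ≡ s n (i ∷ e)
    helper i e (ℕ.≤′-reflexive refl) = refl
    helper i e (ℕ.≤′-step {n} p) = trans (helper i e p)
      (sym (≈[]⇒≡ {f = s (suc n)} {s n} (stable n) i e (s≤s (ℕₚ.≤′⇒≤ p))))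

  infProd≈ : ∀ {F : ℕ → PS (suc N)} → (∀ j → F (suc j) ≈[ suc j ] one) → ∀ n → infProd F ≈[ suc n ] prodTo F n
  infProd≈ {F} F≈1 = lim≈ {prodTo F} (λ j → ≈[]-trans {suc j} {prodTo F (suc j)} {prodTo F j ⊗ one} {prodTo F j}
    (≈[]-*ˡ {suc j} {F (suc j)} {one} (prodTo F j) (F≈1 j))
    (≈⇒≈[] {suc j} {prodTo F j ⊗ one} {prodTo F j} (*-identityʳ (prodTo F j))))

  module _ {q U W X : PS (suc N)} (q∈ : Order≥ 1 q) (U∈ : Order≥ 1 U) (W∈ : Order≥ 1 W) (X∈ : Order≥ 1 X) where
    open Limit {I = Order≥ {N}} (isFiltration {N}) q q∈

    private
      factor : PS (suc N) → ℕ → PS (suc N)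
      factor x i = one ⊕ ⊝ (x ⊗ (q ⊗^ (i ∸ 1)))

      factor≡ : ∀ x i → factor x i ≡ pochFactor x i
      factor≡ x i = cong (λ p → one {suc N} ⊕ ⊝ (x ⊗ p)) (⊗^≡^ q (i ∸ 1))

      factor≈1 : ∀ {x} → Order≥ 1 x → ∀ j → factor x (suc j) ≈[ suc j ] one
      factor≈1 {x} x∈ j = subst (λ f → f ≈[ suc j ] one) (sym (factor≡ x (suc j))) (pochFactor-stable {x} x∈ j)

      ⊝∈ : ∀ {x : PS (suc N)} → Order≥ 1 x → Order≥ 1 (⊝ x)
      ⊝∈ x∈ i e i<1 = cong ℤ.-_ (x∈ i e i<1)

      P Q α : PS (suc N)
      P = poch1 X q
      Q = poch2 (⊝ U) (⊝ W) q
      α = lim (a q U W X)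

      P≈ : ∀ n → P ≈[ suc n ] ∏ (pochFactor X) n
      P≈ n = subst (λ f → P ≈[ suc n ] f) (prodTo≡∏ (factor≡ X) n) (infProd≈ {factor X} (factor≈1 {X} X∈) n)

      factor₂ : ℕ → PS (suc N)
      factor₂ i = factor (⊝ U) i ⊗ factor (⊝ W) i

      factor₂≈1 : ∀ j → factor₂ (suc j) ≈[ suc j ] one
      factor₂≈1 j = ≈[]-trans {suc j} {f ⊗ g} {f ⊗ one} {one}
        (≈[]-*ˡ {suc j} {g} {one} f (factor≈1 {⊝ W} (⊝∈ {W} W∈) j))
        (≈[]-trans {suc j} {f ⊗ one} {f} {one} (≈⇒≈[] {suc j} {f ⊗ one} {f} (*-identityʳ f)) (factor≈1 {⊝ U} (⊝∈ {U} U∈) j))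
        where
        f g : PS (suc N)
        f = factor (⊝ U) (suc j)
        g = factor (⊝ W) (suc j)

      Q≈ : ∀ n → Q ≈[ suc n ] ∏ (pochFactor₂ {U} {W} {X} U∈ W∈ X∈) n
      Q≈ n = subst (λ f → Q ≈[ suc n ] f)
        (prodTo≡∏ (λ i → cong₂ _⊗_ (factor≡ (⊝ U) i) (factor≡ (⊝ W) i)) n)
        (infProd≈ {factor₂} factor₂≈1 n)

    poch-limit : poch1 X q ⊗ α ≐ poch2 (⊝ U) (⊝ W) q
    poch-limit (n ∷ e) = ≈[]⇒≡ {suc n} {P ⊗ α} {Q} P⊗α≈Q n e (ℕₚ.n<1+n n)
      where
      Pₙ Qₙ αₙ : PS (suc N)
      Pₙ = ∏ (pochFactor X) n
      Qₙ = ∏ (pochFactor₂ {U} {W} {X} U∈ W∈ X∈) n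
      αₙ = a q U W X n
      P⊗α≈Q : P ⊗ α ≈[ suc n ] Q
      P⊗α≈Q = ≈[]-trans {suc n} {P ⊗ α} {Pₙ ⊗ α} {Q} (≈[]-*ʳ {suc n} {P} {Pₙ} α (P≈ n))
        (≈[]-trans {suc n} {Pₙ ⊗ α} {Pₙ ⊗ αₙ} {Q}
          (≈[]-*ˡ {suc n} {α} {αₙ} Pₙ (lim≈ {a q U W X} (a-stable {U} {W} {X} U∈ W∈ X∈) n))
          (≈[]-trans {suc n} {Pₙ ⊗ αₙ} {Qₙ} {Q} (a-limit {U} {W} {X} U∈ W∈ X∈ n) (≈[]-sym {suc n} {Q} {Qₙ} (Q≈ n))))

    private
      P-zeroV≡1 : P zeroV ≡ 1ℤ
      -- At x-exponent 0 the infinite product is cut off after no factors, so its value there is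
      -- that of `one` by computation.
      P-zeroV≡1 = mono-≡ {a = zeroV {suc N}} refl

    poch-quotient : poch2 (⊝ U) (⊝ W) q ⊗ inv (poch1 X q) ≐ lim (a q U W X)
    poch-quotient e = begin
      (Q ⊗ inv P) e          ≡⟨ ⊗-cong {f = P ⊗ α} {Q} {inv P} poch-limit (λ _ → refl) e ⟨
      (P ⊗ α ⊗ inv P) e      ≡⟨ ⊗-cong {f = P ⊗ α} {α ⊗ P} {inv P} (⊗-comm P α) (λ _ → refl) e ⟩
      (α ⊗ P ⊗ inv P) e      ≡⟨ ⊗-assoc α P (inv P) e ⟩
      (α ⊗ (P ⊗ inv P)) e    ≡⟨ ⊗-cong {f = α} (λ _ → refl) (Inverse.⊗-inverseʳ P P-zeroV≡1) e ⟩
      (α ⊗ one) e            ≡⟨ *-identityʳ α e ⟩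
      α e                    ∎

-- Generating functions of lists

sumL-cong : ∀ (xs : List A) {f g : A → PS N} → (∀ x → f x ≐ g x) → sumL xs f ≐ sumL xs g
sumL-cong []       p e = refl
sumL-cong (x ∷ xs) p e = cong₂ ℤ._+_ (p x e) (sumL-cong xs p e)

sumL-++ : ∀ (xs ys : List A) (f : A → PS N) → sumL (xs List.++ ys) f ≐ sumL xs f ⊕ sumL ys f
sumL-++ []       ys f e = sym (ℤₚ.+-identityˡ _)
sumL-++ (x ∷ xs) ys f e = trans (cong (λ s → f x e ℤ.+ s) (sumL-++ xs ys f e)) (sym (ℤₚ.+-assoc (f x e) _ _))

sumL-map : ∀ (g : A → B) (xs : List A) (f : B → PS N) → sumL (map g xs) f ≐ sumL xs (f ∘ g)
sumL-map g []       f e = refl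
sumL-map g (x ∷ xs) f e = cong (λ s → f (g x) e ℤ.+ s) (sumL-map g xs f e)

sumL-cartesianProductWith : ∀ (g : A → B → C) (xs : List A) (ys : List B) (f : C → PS N) →
  sumL (cartesianProductWith g xs ys) f ≐ sumL xs (λ x → sumL ys (f ∘ g x))
sumL-cartesianProductWith g []       ys f e = refl
sumL-cartesianProductWith g (x ∷ xs) ys f e = trans (sumL-++ (map (g x) ys) (cartesianProductWith g xs ys) f e)
  (cong₂ ℤ._+_ (sumL-map (g x) ys f e) (sumL-cartesianProductWith g xs ys f e))

sumL-⊗ˡ : ∀ (c : PS N) (xs : List A) (f : A → PS N) → sumL xs (λ x → c ⊗ f x) ≐ c ⊗ sumL xs f
sumL-⊗ˡ c []       f e = sym (⊗≡0ʳ c (λ _ → 0ℤ) (λ _ → refl) e)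
sumL-⊗ˡ c (x ∷ xs) f e = trans (cong (λ s → (c ⊗ f x) e ℤ.+ s) (sumL-⊗ˡ c xs f e))
  (sym (⊗-distribˡ c (f x) (sumL xs f) e))

sumL-⊗ʳ : ∀ (c : PS N) (xs : List A) (f : A → PS N) → sumL xs (λ x → f x ⊗ c) ≐ sumL xs f ⊗ c
sumL-⊗ʳ c xs f e = trans (sumL-cong xs (λ x → ⊗-comm (f x) c) e)
  (trans (sumL-⊗ˡ c xs f e) (⊗-comm c (sumL xs f) e))

sumL-mono≡length-filter : ∀ (w : A → Vec ℕ N) (e : Vec ℕ N) (xs : List A) →
  sumL xs (mono ∘ w) e ≡ + List.length (List.filter (λ x → Vecₚ.≡-dec ℕ._≟_ (w x) e) xs)
sumL-mono≡length-filter w e []       = refl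
sumL-mono≡length-filter w e (x ∷ xs) = helper (Vecₚ.≡-dec ℕ._≟_ (w x) e)
  where
  P? : ∀ y → Dec (w y ≡ e)
  P? y = Vecₚ.≡-dec ℕ._≟_ (w y) e
  helper : Dec (w x ≡ e) → sumL (x ∷ xs) (mono ∘ w) e ≡ + List.length (List.filter P? (x ∷ xs))
  helper (yes p) = trans (cong₂ ℤ._+_ (mono-≡ p) (sumL-mono≡length-filter w e xs))
    (cong (λ l → + List.length l) (sym (Listₚ.filter-accept P? {x} {xs} p)))
  helper (no ¬p) = trans (cong₂ ℤ._+_ (mono-≢ ¬p) (sumL-mono≡length-filter w e xs))
    (trans (ℤₚ.+-identityˡ _) (cong (λ l → + List.length l) (sym (Listₚ.filter-reject P? {x} {xs} ¬p))))

-- Enumeration of 𝒟𝒮ᵏ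

module Enumeration (r : ℕ) where

  k : ℕ
  k = suc r

  addResidue : ℕ → Fin r → List ℕ → List ℕ
  addResidue m j π = m ℕ.* k ℕ.+ suc (toℕ j) ∷ π

  -- By k-strictness at most one part lies strictly between mk and (m+1)k. The multiple (m+1)k is
  -- added in a separate stage, so that each stage prepends at most one part.
  extend : ℕ → List (List ℕ) → List (List ℕ)
  extend m L = L List.++ cartesianProductWith (addResidue m) (allFin r) L

  mutual
    enum : ℕ → List (List ℕ)
    enum zero    = [] ∷ []
    enum (suc m) = enumBelow m List.++ map (suc m ℕ.* k ∷_) (enumBelow m)

    enumBelow : ℕ → List (List ℕ)
    enumBelow m = extend m (enum m)

  residue : ∀ m {s} → s < k → (m ℕ.* k ℕ.+ s) ℕ.% k ≡ s
  residue m {s} s<k = trans (cong (ℕ._% k) (ℕₚ.+-comm (m ℕ.* k) s))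
    (trans (DivMod.[m+kn]%n≡m%n s m k) (DivMod.m<n⇒m%n≡m s<k))

  block-unique : ∀ {m m′ s s′} → s < k → s′ < k → m ℕ.* k ℕ.+ s ≡ m′ ℕ.* k ℕ.+ s′ → m ≡ m′ × s ≡ s′
  block-unique {m} {m′} {s} {s′} s<k s′<k p = m≡m′ , s≡s′
    where
    s≡s′ : s ≡ s′
    s≡s′ = trans (sym (residue m s<k)) (trans (cong (ℕ._% k) p) (residue m′ s′<k))
    m≡m′ : m ≡ m′
    m≡m′ = ℕₚ.*-cancelʳ-≡ m m′ k (ℕₚ.+-cancelʳ-≡ s (m ℕ.* k) (m′ ℕ.* k) (trans p (cong (m′ ℕ.* k ℕ.+_) (sym s≡s′))))

  KStrict-[] : KStrict k []
  KStrict-[] m r₁ r₂ ()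

  KStrict-tail : ∀ {p π} → KStrict k (p ∷ π) → KStrict k π
  KStrict-tail s m r₁ r₂ i j 1≤r₁ r₁≤r₂ r₂≤ i≢j =
    s m r₁ r₂ (suc i) (suc j) 1≤r₁ r₁≤r₂ r₂≤ (i≢j ∘ Finₚ.suc-injective)

  -- The hypothesis leaves the order of r₁ and r₂ open, so that it serves both when the new head is
  -- the first of the two positions and when it is the second.
  KStrict-∷ : ∀ {p π} → KStrict k π →
    (∀ m r₁ r₂ q → q ∈ π → 1 ≤ r₁ → r₁ < k → 1 ≤ r₂ → r₂ < k →
      p ≡ m ℕ.* k ℕ.+ r₁ → q ≡ m ℕ.* k ℕ.+ r₂ → ⊥) →
    KStrict k (p ∷ π)
  KStrict-∷ s h m r₁ r₂ zero    zero    1≤r₁ r₁≤r₂ r₂≤ i≢j pᵢ pⱼ = i≢j refl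
  KStrict-∷ {π = π} s h m r₁ r₂ zero    (suc j) 1≤r₁ r₁≤r₂ r₂≤ i≢j pᵢ pⱼ =
    h m r₁ r₂ (List.lookup π j) (∈-lookup {xs = π} j) 1≤r₁ (s≤s (ℕₚ.≤-trans r₁≤r₂ r₂≤))
      (ℕₚ.≤-trans 1≤r₁ r₁≤r₂) (s≤s r₂≤) pᵢ pⱼ
  KStrict-∷ {π = π} s h m r₁ r₂ (suc i) zero    1≤r₁ r₁≤r₂ r₂≤ i≢j pᵢ pⱼ =
    h m r₂ r₁ (List.lookup π i) (∈-lookup {xs = π} i) (ℕₚ.≤-trans 1≤r₁ r₁≤r₂) (s≤s r₂≤)
      1≤r₁ (s≤s (ℕₚ.≤-trans r₁≤r₂ r₂≤)) pⱼ pᵢ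
  KStrict-∷ s h m r₁ r₂ (suc i) (suc j) 1≤r₁ r₁≤r₂ r₂≤ i≢j pᵢ pⱼ =
    s m r₁ r₂ i j 1≤r₁ r₁≤r₂ r₂≤ (i≢j ∘ cong suc) pᵢ pⱼ

  DS-tail : ∀ {p π} → DS k (p ∷ π) → DS k π
  DS-tail ((desc , _ ∷ pos) , s) = (Linked.tail desc , pos) , KStrict-tail s

  DS⇒tail< : ∀ {p π} → DS k (p ∷ π) → All (_< p) π
  DS⇒tail< ((desc , _) , _) with Linkedₚ.Linked⇒AllPairs (λ p>q q>r → ℕₚ.<-trans q>r p>q) desc
  ... | π<p AllPairs.∷ _ = π<p

  Linked-∷ : ∀ {p π} → All (_< p) π → Linked ℕ._>_ π → Linked ℕ._>_ (p ∷ π)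
  Linked-∷ []        []         = [-]
  Linked-∷ (q<p ∷ _) desc@[-]      = q<p ∷ desc
  Linked-∷ (q<p ∷ _) desc@(_ ∷ _)  = q<p ∷ desc

  DS-addResidue : ∀ m j {π} → DS k π → All (_≤ m ℕ.* k) π → DS k (addResidue m j π)
  DS-addResidue m j {π} ((desc , pos) , s) π≤ =
    (Linked-∷ (All.map (λ q≤ → ℕₚ.≤-<-trans q≤ (ℕₚ.m<m+n _ (s≤s z≤n))) π≤) desc ,
     ℕₚ.<-≤-trans (s≤s z≤n) (ℕₚ.m≤n+m (suc (toℕ j)) (m ℕ.* k)) ∷ pos) ,
    KStrict-∷ s λ m′ r₁ r₂ q q∈ 1≤r₁ r₁<k 1≤r₂ r₂<k p≡ q≡ →
      let m≡m′ , _ = block-unique {m} {m′} (s≤s (Finₚ.toℕ<n j)) r₁<k p≡ in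
      ℕₚ.<⇒≱ (subst (m ℕ.* k <_) (sym (trans q≡ (cong (λ x → x ℕ.* k ℕ.+ r₂) (sym m≡m′)))) (ℕₚ.m<m+n _ 1≤r₂))
        (All.lookup π≤ q∈)

  DS-addMultiple : ∀ m {π} → DS k π → All (_< suc m ℕ.* k) π → DS k (suc m ℕ.* k ∷ π)
  DS-addMultiple m ((desc , pos) , s) π< =
    (Linked-∷ π< desc , s≤s z≤n ∷ pos) ,
    KStrict-∷ s λ m′ r₁ r₂ q q∈ 1≤r₁ r₁<k 1≤r₂ r₂<k p≡ q≡ →
      ℕₚ.<⇒≢ 1≤r₁ (proj₂ (block-unique {suc m} {m′} {0} (s≤s z≤n) r₁<k (trans (ℕₚ.+-identityʳ (suc m ℕ.* k)) p≡)))

  residue< : ∀ m (j : Fin r) → m ℕ.* k ℕ.+ suc (toℕ j) < suc m ℕ.* k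
  residue< m j = subst (m ℕ.* k ℕ.+ suc (toℕ j) <_) (ℕₚ.+-comm (m ℕ.* k) k)
    (ℕₚ.+-monoʳ-< (m ℕ.* k) (s≤s (Finₚ.toℕ<n j)))

  mutual
    enum-sound : ∀ m {π} → π ∈ enum m → DS k π × All (_≤ m ℕ.* k) π
    enum-sound zero    (here refl) = (([] , []) , KStrict-[]) , []
    enum-sound (suc m) π∈ with ∈-++⁻ (enumBelow m) π∈
    ... | inj₁ π∈below = let ds , π< = enumBelow-sound m π∈below in ds , All.map ℕₚ.<⇒≤ π<
    ... | inj₂ π∈map with ∈-map⁻ (suc m ℕ.* k ∷_) π∈map
    ... | π′ , π′∈ , refl =
      let ds , π′< = enumBelow-sound m π′∈ in DS-addMultiple m ds π′< , ℕₚ.≤-refl ∷ All.map ℕₚ.<⇒≤ π′<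

    enumBelow-sound : ∀ m {π} → π ∈ enumBelow m → DS k π × All (_< suc m ℕ.* k) π
    enumBelow-sound m π∈ with ∈-++⁻ (enum m) π∈
    ... | inj₁ π∈enum = let ds , π≤ = enum-sound m π∈enum in ds , All.map (λ q≤ → s≤s (ℕₚ.≤-trans q≤ (ℕₚ.m≤n+m _ r))) π≤
    ... | inj₂ π∈prod with ∈-cartesianProductWith⁻ (addResidue m) (allFin r) (enum m) π∈prod
    ... | j , π′ , _ , π′∈ , refl =
      let ds , π′≤ = enum-sound m π′∈ in
      DS-addResidue m j ds π′≤ , residue< m j ∷ All.map (λ q≤ → s≤s (ℕₚ.≤-trans q≤ (ℕₚ.m≤n+m _ r))) π′≤

  -- A further part q above mk is smaller than the head, hence of the form mk + r₁ with 1 ≤ r₁ ≤ k -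
  -- 1, in the same block as the head. This is where completeness of the enumeration draws on
  -- k-strictness.
  below-residue : ∀ m (j : Fin r) {π} → DS k (addResidue m j π) → All (_≤ m ℕ.* k) π
  below-residue m j {π} ds@(_ , s) = All.tabulate λ {q} q∈ → ℕₚ.≮⇒≥ λ mk<q →
    let q<p = All.lookup (DS⇒tail< ds) q∈
        r₁ , mk+r₁≡q = ℕₚ.m≤n⇒∃[o]m+o≡n (ℕₚ.<⇒≤ mk<q)
        1≤r₁ = ℕₚ.+-cancelˡ-< (m ℕ.* k) 0 r₁ (subst₂ _<_ (sym (ℕₚ.+-identityʳ _)) (sym mk+r₁≡q) mk<q)
        r₁≤ = ℕₚ.<⇒≤ (ℕₚ.+-cancelˡ-< (m ℕ.* k) r₁ (suc (toℕ j)) (subst (_< m ℕ.* k ℕ.+ suc (toℕ j)) (sym mk+r₁≡q) q<p))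
    -- The smaller residue belongs to q, so q takes the first position and the head the second.
    in s m r₁ (suc (toℕ j)) (suc (Any.index q∈)) zero 1≤r₁ r₁≤ (Finₚ.toℕ<n j) (λ ())
         (trans (sym (Anyₚ.lookup-index q∈)) (sym mk+r₁≡q)) refl

  mutual
    enum-complete : ∀ m {π} → DS k π → All (_≤ m ℕ.* k) π → π ∈ enum m
    enum-complete zero    {[]}    ds π≤ = here refl
    enum-complete zero    {p ∷ π} ((_ , 0<p ∷ _) , _) (p≤0 ∷ _) = contradiction p≤0 (ℕₚ.<⇒≱ 0<p)
    enum-complete (suc m) {[]}    ds π≤ = ∈-++⁺ˡ (enumBelow-complete m ds [])
    enum-complete (suc m) {p ∷ π} ds (p≤ ∷ _) with ℕₚ.m≤n⇒m<n∨m≡n p≤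
    ... | inj₁ p<   = ∈-++⁺ˡ (enumBelow-complete m ds (p< ∷ All.map (λ q<p → ℕₚ.<-trans q<p p<) (DS⇒tail< ds)))
    ... | inj₂ refl = ∈-++⁺ʳ (enumBelow m) (∈-map⁺ (suc m ℕ.* k ∷_) (enumBelow-complete m (DS-tail ds) (DS⇒tail< ds)))

    enumBelow-complete : ∀ m {π} → DS k π → All (_< suc m ℕ.* k) π → π ∈ enumBelow m
    enumBelow-complete m {[]}    ds π< = ∈-++⁺ˡ (enum-complete m ds [])
    enumBelow-complete m {p ∷ π} ds (p< ∷ _) with p ℕ.≤? m ℕ.* k
    ... | yes p≤ = ∈-++⁺ˡ (enum-complete m ds (p≤ ∷ All.map (λ q<p → ℕₚ.≤-trans (ℕₚ.<⇒≤ q<p) p≤) (DS⇒tail< ds)))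
    ... | no p≰ with ℕₚ.m≤n⇒∃[o]m+o≡n (ℕₚ.≰⇒> p≰)
    ... | s , refl = subst (λ p → p ∷ π ∈ enumBelow m) (sym p≡)
        (∈-++⁺ʳ (enum m) (∈-cartesianProductWith⁺ (addResidue m) (∈-allFin j)
          (enum-complete m (DS-tail ds) (below-residue m j (subst (λ p → DS k (p ∷ π)) p≡ ds)))))
      where
      s<r : s < r
      s<r = ℕₚ.+-cancelˡ-< (m ℕ.* k) s r (ℕ.s≤s⁻¹ (subst (suc (m ℕ.* k ℕ.+ s) <_) (cong suc (ℕₚ.+-comm r (m ℕ.* k))) p<))
      j : Fin r
      j = Fin.fromℕ< s<r
      p≡ : suc (m ℕ.* k) ℕ.+ s ≡ m ℕ.* k ℕ.+ suc (toℕ j)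
      p≡ = trans (sym (ℕₚ.+-suc (m ℕ.* k) s)) (cong (λ t → m ℕ.* k ℕ.+ suc t) (sym (Finₚ.toℕ-fromℕ< s<r)))

  mutual
    -- The two halves of each concatenation are separated by their heads: a newly prepended part
    -- exceeds every part in the lists of the other half.
    enum-unique : ∀ m → Unique (enum m)
    enum-unique zero    = [] AllPairs.∷ AllPairs.[]
    enum-unique (suc m) = Uniqueₚ.++⁺ (enumBelow-unique m) (Uniqueₚ.map⁺ Listₚ.∷-injectiveʳ (enumBelow-unique m)) disjoint
      where
      disjoint : ∀ {π} → π ∈ enumBelow m × π ∈ map (suc m ℕ.* k ∷_) (enumBelow m) → ⊥
      disjoint (π∈ , π∈map) with ∈-map⁻ (suc m ℕ.* k ∷_) π∈map
      ... | _ , _ , refl = ℕₚ.<-irrefl refl (All.head (proj₂ (enumBelow-sound m π∈)))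

    enumBelow-unique : ∀ m → Unique (enumBelow m)
    enumBelow-unique m = Uniqueₚ.++⁺ (enum-unique m)
      (Uniqueₚ.cartesianProductWith⁺ (addResidue m) addResidue-injective (Uniqueₚ.allFin⁺ r) (enum-unique m)) disjoint
      where
      addResidue-injective : ∀ {i j π ρ} → addResidue m i π ≡ addResidue m j ρ → i ≡ j × π ≡ ρ
      addResidue-injective p = Finₚ.toℕ-injective (ℕₚ.suc-injective (ℕₚ.+-cancelˡ-≡ (m ℕ.* k) _ _ (Listₚ.∷-injectiveˡ p))) , Listₚ.∷-injectiveʳ p
      disjoint : ∀ {π} → π ∈ enum m × π ∈ cartesianProductWith (addResidue m) (allFin r) (enum m) → ⊥
      disjoint (π∈ , π∈prod) with ∈-cartesianProductWith⁻ (addResidue m) (allFin r) (enum m) π∈prod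
      ... | j , _ , _ , _ , refl = ℕₚ.m+1+n≰m (m ℕ.* k) (All.head (proj₂ (enum-sound m π∈)))

-- Exponent vectors of partitions and the block recurrence

module Weights (r : ℕ) where
  open Enumeration r

  indicator : ℕ → Vec ℕ r
  indicator p = Vec.tabulate (λ j → if does (p ℕ.% k ℕ.≟ suc (toℕ j)) then 1 else 0)

  residues : List ℕ → Vec ℕ r
  residues ps = Vec.tabulate (λ j → countRes k (suc (toℕ j)) ps)

  weight₀ weight₁ : List ℕ → Vec ℕ (NV k)
  weight₀ π = oddSum π ∷ evenSum π ∷ residues (oddParts π) Vec.++ residues (evenParts π)
  weight₁ π = evenSum π ∷ oddSum π ∷ residues (evenParts π) Vec.++ residues (oddParts π)

  -- Exponent vectors of x^p u^h and y^p v^h, the contributions of a part p in odd and in even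
  -- position.
  partWeight₀ partWeight₁ : ℕ → Vec ℕ r → Vec ℕ (NV k)
  partWeight₀ p h = p ∷ 0 ∷ h Vec.++ zeroV
  partWeight₁ p h = 0 ∷ p ∷ zeroV Vec.++ h

  infixl 6 _+ᵥ_
  _+ᵥ_ : ∀ {n} → Vec ℕ n → Vec ℕ n → Vec ℕ n
  _+ᵥ_ = zipWith ℕ._+_

  tabulate-+ᵥ : ∀ {n} (f g : Fin n → ℕ) → Vec.tabulate (λ i → f i ℕ.+ g i) ≡ Vec.tabulate f +ᵥ Vec.tabulate g
  tabulate-+ᵥ {zero}  f g = refl
  tabulate-+ᵥ {suc n} f g = cong (f zero ℕ.+ g zero ∷_) (tabulate-+ᵥ (f ∘ suc) (g ∘ suc))

  residues-∷ : ∀ p ps → residues (p ∷ ps) ≡ indicator p +ᵥ residues ps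
  residues-∷ p ps = trans (Vecₚ.tabulate-cong (λ j → countRes-∷ (suc (toℕ j)) (p ℕ.% k ℕ.≟ suc (toℕ j))))
    (tabulate-+ᵥ _ _)
    where
    countRes-∷ : ∀ l (d : Dec (p ℕ.% k ≡ l)) →
      countRes k l (p ∷ ps) ≡ (if does (p ℕ.% k ℕ.≟ l) then 1 else 0) ℕ.+ countRes k l ps
    countRes-∷ l (yes p≡) rewrite dec-true (p ℕ.% k ℕ.≟ l) p≡ = refl
    countRes-∷ l (no p≢) rewrite dec-false (p ℕ.% k ℕ.≟ l) p≢ = refl

  zeroV-+ᵥ : ∀ {n} (v : Vec ℕ n) → zeroV +ᵥ v ≡ v
  zeroV-+ᵥ = Vecₚ.zipWith-identityˡ ℕₚ.+-identityˡ

  +ᵥ-zeroV : ∀ {n} (v : Vec ℕ n) → v +ᵥ zeroV ≡ v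
  +ᵥ-zeroV = Vecₚ.zipWith-identityʳ ℕₚ.+-identityʳ

  weight₀-∷ : ∀ p π → weight₀ (p ∷ π) ≡ partWeight₀ p (indicator p) +ᵥ weight₁ π
  weight₀-∷ p π = cong (λ v → _ ∷ _ ∷ v) (trans
    (cong₂ Vec._++_ (residues-∷ p (evenParts π)) (sym (zeroV-+ᵥ _)))
    (sym (Vecₚ.zipWith-++ ℕ._+_ (indicator p) zeroV (residues (evenParts π)) (residues (oddParts π)))))

  weight₁-∷ : ∀ p π → weight₁ (p ∷ π) ≡ partWeight₁ p (indicator p) +ᵥ weight₀ π
  weight₁-∷ p π = cong (λ v → _ ∷ _ ∷ v) (trans
    (cong₂ Vec._++_ (sym (zeroV-+ᵥ _)) (residues-∷ p (evenParts π)))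
    (sym (Vecₚ.zipWith-++ ℕ._+_ zeroV (indicator p) (residues (oddParts π)) (residues (evenParts π)))))

  partWeight₀-+ : ∀ p q h h′ → partWeight₀ (p ℕ.+ q) (h +ᵥ h′) ≡ partWeight₀ p h +ᵥ partWeight₀ q h′
  partWeight₀-+ p q h h′ = cong (λ v → _ ∷ _ ∷ v) (trans
    (cong ((h +ᵥ h′) Vec.++_) (sym (zeroV-+ᵥ zeroV))) (sym (Vecₚ.zipWith-++ ℕ._+_ h zeroV h′ zeroV)))

  partWeight₁-+ : ∀ p q h h′ → partWeight₁ (p ℕ.+ q) (h +ᵥ h′) ≡ partWeight₁ p h +ᵥ partWeight₁ q h′
  partWeight₁-+ p q h h′ = cong (λ v → _ ∷ _ ∷ v) (trans
    (cong (Vec._++ (h +ᵥ h′)) (sym (zeroV-+ᵥ zeroV))) (sym (Vecₚ.zipWith-++ ℕ._+_ zeroV h zeroV h′)))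

  tabulate-zeroV : ∀ {n} {f : Fin n → ℕ} → (∀ i → f i ≡ 0) → Vec.tabulate f ≡ zeroV
  tabulate-zeroV f≡0 = trans (Vecₚ.tabulate-cong (λ i → trans (f≡0 i) (sym (Vecₚ.lookup-replicate i 0))))
    (Vecₚ.tabulate∘lookup zeroV)

  indicator-multiple : ∀ m → indicator (m ℕ.* k) ≡ zeroV
  indicator-multiple m = tabulate-zeroV λ j → cong (λ b → if b then 1 else 0)
    (dec-false (m ℕ.* k ℕ.% k ℕ.≟ suc (toℕ j)) (λ p → ℕₚ.0≢1+n (trans (sym (DivMod.m*n%n≡0 m k)) p)))

  indicator-residue : ∀ m (j : Fin r) → indicator (m ℕ.* k ℕ.+ suc (toℕ j)) ≡ unitV j
  indicator-residue m j = Vecₚ.tabulate-cong (λ i → cong (λ b → if b then 1 else 0) (helper i (i Fin.≟ j)))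
    where
    p : ℕ
    p = m ℕ.* k ℕ.+ suc (toℕ j)
    p%k≡ : p ℕ.% k ≡ suc (toℕ j)
    p%k≡ = residue m (s≤s (Finₚ.toℕ<n j))
    helper : ∀ i → Dec (i ≡ j) → does (p ℕ.% k ℕ.≟ suc (toℕ i)) ≡ does (i Fin.≟ j)
    helper i (yes refl) = trans (dec-true (p ℕ.% k ℕ.≟ suc (toℕ i)) p%k≡) (sym (dec-true (i Fin.≟ j) refl))
    helper i (no i≢j) = trans
      (dec-false (p ℕ.% k ℕ.≟ suc (toℕ i)) (λ eq → i≢j (Finₚ.toℕ-injective (ℕₚ.suc-injective (trans (sym eq) p%k≡)))))
      (sym (dec-false (i Fin.≟ j) i≢j))

  open Recurrence (PS-commutativeRing (NV k)) using (_^_; a; t₀≈a×X^t₁≈b)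

  X Y U V W q : PS (NV k)
  X = mono (partWeight₀ k zeroV)
  Y = mono (partWeight₁ k zeroV)
  U = sumUX k
  V = sumL (allFin r) (λ j → mono (partWeight₁ (suc (toℕ j)) (unitV j)))
  W = sumXVY k
  q = monoK k k k zeroV zeroV

  zeroV-++ : ∀ m {n} → zeroV {m} Vec.++ zeroV {n} ≡ zeroV
  zeroV-++ zero    = refl
  zeroV-++ (suc m) = cong (0 ∷_) (zeroV-++ m)

  -- Removing the largest part swaps odd- and even-indexed parts; w and w′ are the two weights so exchanged.
  module Alternation (w w′ : List ℕ → Vec ℕ (NV k)) (pw : ℕ → Vec ℕ r → Vec ℕ (NV k))
    (w-∷ : ∀ p π → w (p ∷ π) ≡ pw p (indicator p) +ᵥ w′ π)
    (pw-+ : ∀ p q h h′ → pw (p ℕ.+ q) (h +ᵥ h′) ≡ pw p h +ᵥ pw q h′)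
    (pw-0 : pw 0 zeroV ≡ zeroV) where

    Z S : PS (NV k)
    Z = mono (pw k zeroV)
    S = sumL (allFin r) (λ j → mono (pw (suc (toℕ j)) (unitV j)))

    Z^≐ : ∀ m → mono (pw (m ℕ.* k) zeroV) ≐ Z ^ m
    Z^≐ zero    e = cong (λ v → mono v e) pw-0
    Z^≐ (suc m) e = begin
      mono (pw (k ℕ.+ m ℕ.* k) zeroV) e
        ≡⟨ cong (λ v → mono (pw (k ℕ.+ m ℕ.* k) v) e) (zeroV-+ᵥ zeroV) ⟨
      mono (pw (k ℕ.+ m ℕ.* k) (zeroV +ᵥ zeroV)) e
        ≡⟨ cong (λ v → mono v e) (pw-+ k (m ℕ.* k) zeroV zeroV) ⟩
      mono (pw k zeroV +ᵥ pw (m ℕ.* k) zeroV) e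
        ≡⟨ mono-+ (pw k zeroV) (pw (m ℕ.* k) zeroV) e ⟩
      (Z ⊗ mono (pw (m ℕ.* k) zeroV)) e
        ≡⟨ ⊗-cong {f = Z} (λ _ → refl) (Z^≐ m) e ⟩
      (Z ⊗ Z ^ m) e ∎

    mono-w-addMultiple : ∀ m π → mono (w (m ℕ.* k ∷ π)) ≐ Z ^ m ⊗ mono (w′ π)
    mono-w-addMultiple m π e = begin
      mono (w (m ℕ.* k ∷ π)) e
        ≡⟨ cong (λ v → mono v e) (w-∷ (m ℕ.* k) π) ⟩
      mono (pw (m ℕ.* k) (indicator (m ℕ.* k)) +ᵥ w′ π) e
        ≡⟨ cong (λ h → mono (pw (m ℕ.* k) h +ᵥ w′ π) e) (indicator-multiple m) ⟩
      mono (pw (m ℕ.* k) zeroV +ᵥ w′ π) e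
        ≡⟨ mono-+ (pw (m ℕ.* k) zeroV) (w′ π) e ⟩
      (mono (pw (m ℕ.* k) zeroV) ⊗ mono (w′ π)) e
        ≡⟨ ⊗-cong {g = mono (w′ π)} (Z^≐ m) (λ _ → refl) e ⟩
      (Z ^ m ⊗ mono (w′ π)) e ∎

    mono-w-addResidue : ∀ m j π →
      mono (w (addResidue m j π)) ≐ mono (pw (suc (toℕ j)) (unitV j)) ⊗ Z ^ m ⊗ mono (w′ π)
    mono-w-addResidue m j π e = begin
      mono (w (addResidue m j π)) e
        ≡⟨ cong (λ v → mono v e) (w-∷ (m ℕ.* k ℕ.+ s) π) ⟩
      mono (pw (m ℕ.* k ℕ.+ s) (indicator (m ℕ.* k ℕ.+ s)) +ᵥ w′ π) e
        ≡⟨ cong₂ (λ p h → mono (pw p h +ᵥ w′ π) e) (ℕₚ.+-comm (m ℕ.* k) s)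
             (trans (indicator-residue m j) (sym (+ᵥ-zeroV (unitV j)))) ⟩
      mono (pw (s ℕ.+ m ℕ.* k) (unitV j +ᵥ zeroV) +ᵥ w′ π) e
        ≡⟨ cong (λ v → mono (v +ᵥ w′ π) e) (pw-+ s (m ℕ.* k) (unitV j) zeroV) ⟩
      mono (pw s (unitV j) +ᵥ pw (m ℕ.* k) zeroV +ᵥ w′ π) e
        ≡⟨ mono-+ (pw s (unitV j) +ᵥ pw (m ℕ.* k) zeroV) (w′ π) e ⟩
      (mono (pw s (unitV j) +ᵥ pw (m ℕ.* k) zeroV) ⊗ mono (w′ π)) e
        ≡⟨ ⊗-cong {g = mono (w′ π)} (mono-+ (pw s (unitV j)) (pw (m ℕ.* k) zeroV)) (λ _ → refl) e ⟩
      (mono (pw s (unitV j)) ⊗ mono (pw (m ℕ.* k) zeroV) ⊗ mono (w′ π)) e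
        ≡⟨ ⊗-cong {g = mono (w′ π)} (⊗-cong {f = mono (pw s (unitV j))} (λ _ → refl) (Z^≐ m)) (λ _ → refl) e ⟩
      (mono (pw s (unitV j)) ⊗ Z ^ m ⊗ mono (w′ π)) e ∎
      where
      s : ℕ
      s = suc (toℕ j)

    sumL-enumBelow : ∀ m → sumL (enumBelow m) (mono ∘ w)
      ≐ sumL (enum m) (mono ∘ w) ⊕ S ⊗ Z ^ m ⊗ sumL (enum m) (mono ∘ w′)
    sumL-enumBelow m e = begin
      sumL (enumBelow m) (mono ∘ w) e
        ≡⟨ sumL-++ (enum m) (cartesianProductWith (addResidue m) (allFin r) (enum m)) (mono ∘ w) e ⟩
      sumL (enum m) (mono ∘ w) e ℤ.+ sumL (cartesianProductWith (addResidue m) (allFin r) (enum m)) (mono ∘ w) e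
        ≡⟨ cong (λ s → sumL (enum m) (mono ∘ w) e ℤ.+ s) (begin
          sumL (cartesianProductWith (addResidue m) (allFin r) (enum m)) (mono ∘ w) e
            ≡⟨ sumL-cartesianProductWith (addResidue m) (allFin r) (enum m) (mono ∘ w) e ⟩
          sumL (allFin r) (λ j → sumL (enum m) (λ π → mono (w (addResidue m j π)))) e
            ≡⟨ sumL-cong (allFin r) (λ j e → trans
                 (sumL-cong (enum m) (mono-w-addResidue m j) e)
                 (sumL-⊗ˡ (u j ⊗ Z ^ m) (enum m) (mono ∘ w′) e)) e ⟩
          sumL (allFin r) (λ j → u j ⊗ Z ^ m ⊗ T) e
            ≡⟨ sumL-⊗ʳ T (allFin r) (λ j → u j ⊗ Z ^ m) e ⟩
          (sumL (allFin r) (λ j → u j ⊗ Z ^ m) ⊗ T) e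
            ≡⟨ ⊗-cong {g = T} (sumL-⊗ʳ (Z ^ m) (allFin r) u) (λ _ → refl) e ⟩
          (S ⊗ Z ^ m ⊗ T) e ∎) ⟩
      (sumL (enum m) (mono ∘ w) ⊕ S ⊗ Z ^ m ⊗ T) e ∎
      where
      T : PS (NV k)
      T = sumL (enum m) (mono ∘ w′)
      u : Fin r → PS (NV k)
      u j = mono (pw (suc (toℕ j)) (unitV j))

    sumL-enum-suc : ∀ m → sumL (enum (suc m)) (mono ∘ w)
      ≐ sumL (enumBelow m) (mono ∘ w) ⊕ Z ^ suc m ⊗ sumL (enumBelow m) (mono ∘ w′)
    sumL-enum-suc m e = trans
      (sumL-++ (enumBelow m) (map (suc m ℕ.* k ∷_) (enumBelow m)) (mono ∘ w) e)
      (cong (λ s → sumL (enumBelow m) (mono ∘ w) e ℤ.+ s) (begin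
        sumL (map (suc m ℕ.* k ∷_) (enumBelow m)) (mono ∘ w) e
          ≡⟨ sumL-map (suc m ℕ.* k ∷_) (enumBelow m) (mono ∘ w) e ⟩
        sumL (enumBelow m) (λ π → mono (w (suc m ℕ.* k ∷ π))) e
          ≡⟨ sumL-cong (enumBelow m) (mono-w-addMultiple (suc m)) e ⟩
        sumL (enumBelow m) (λ π → Z ^ suc m ⊗ mono (w′ π)) e
          ≡⟨ sumL-⊗ˡ (Z ^ suc m) (enumBelow m) (mono ∘ w′) e ⟩
        (Z ^ suc m ⊗ sumL (enumBelow m) (mono ∘ w′)) e ∎))

  module Alt₀ = Alternation weight₀ weight₁ partWeight₀ weight₀-∷ partWeight₀-+ (cong (λ v → 0 ∷ 0 ∷ v) (zeroV-++ r))
  module Alt₁ = Alternation weight₁ weight₀ partWeight₁ weight₁-∷ partWeight₁-+ (cong (λ v → 0 ∷ 0 ∷ v) (zeroV-++ r))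

  t₀ t₁ : ℕ → PS (NV k)
  t₀ m = sumL (enum m) (mono ∘ weight₀)
  t₁ m = sumL (enum m) (mono ∘ weight₁)

  t₀-suc : ∀ m → t₀ (suc m) ≐ (t₀ m ⊕ U ⊗ X ^ m ⊗ t₁ m) ⊕ X ^ suc m ⊗ (t₁ m ⊕ V ⊗ Y ^ m ⊗ t₀ m)
  t₀-suc m e = trans (Alt₀.sumL-enum-suc m e)
    (cong₂ ℤ._+_ (Alt₀.sumL-enumBelow m e) (⊗-cong {f = X ^ suc m} (λ _ → refl) (Alt₁.sumL-enumBelow m) e))

  t₁-suc : ∀ m → t₁ (suc m) ≐ (t₁ m ⊕ V ⊗ Y ^ m ⊗ t₀ m) ⊕ Y ^ suc m ⊗ (t₀ m ⊕ U ⊗ X ^ m ⊗ t₁ m)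
  t₁-suc m e = trans (Alt₁.sumL-enum-suc m e)
    (cong₂ ℤ._+_ (Alt₁.sumL-enumBelow m e) (⊗-cong {f = Y ^ suc m} (λ _ → refl) (Alt₀.sumL-enumBelow m) e))

  residues-[] : residues [] ≡ zeroV
  residues-[] = tabulate-zeroV (λ _ → refl)

  weights-[] : residues [] Vec.++ residues [] ≡ zeroV
  weights-[] = trans (cong₂ Vec._++_ residues-[] residues-[]) (zeroV-++ r)

  t₀-zero : t₀ 0 ≐ one
  t₀-zero e = trans (ℤₚ.+-identityʳ _) (cong (λ v → mono (0 ∷ 0 ∷ v) e) weights-[])

  t₁-zero : t₁ 0 ≐ one
  t₁-zero e = trans (ℤₚ.+-identityʳ _) (cong (λ v → mono (0 ∷ 0 ∷ v) e) weights-[])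

  mono-X⊗ : ∀ p h → monoK k k p zeroV h ≐ X ⊗ mono (partWeight₁ p h)
  mono-X⊗ p h e = trans
    (cong₂ (λ m v → mono (m ∷ p ∷ v) e) (sym (ℕₚ.+-identityʳ k))
      (trans (sym (zeroV-+ᵥ (zeroV Vec.++ h))) (cong (_+ᵥ (zeroV Vec.++ h)) (sym (zeroV-++ r)))))
    (mono-+ (partWeight₀ k zeroV) (partWeight₁ p h) e)

  q≐X⊗Y : q ≐ X ⊗ Y
  q≐X⊗Y = mono-X⊗ k zeroV

  W≐X⊗V : W ≐ X ⊗ V
  W≐X⊗V e = trans (sumL-cong (allFin r) (λ j → mono-X⊗ (suc (toℕ j)) (unitV j)) e)
    (sumL-⊗ˡ X (allFin r) (λ j → mono (partWeight₁ (suc (toℕ j)) (unitV j))) e)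

  Order≥₁-mono : ∀ n (v : Vec ℕ (suc (r ℕ.+ r))) → Order≥ 1 (mono (suc n ∷ v))
  Order≥₁-mono n v i e i<1 = Order≥-mono (suc n) v i e (ℕₚ.<-≤-trans i<1 (s≤s z≤n))

  t₀≐a : ∀ m → t₀ m ≐ a q U W X m
  t₀≐a m = proj₁ (t₀≈a×X^t₁≈b {q} {U} {V} {W} {X} {Y} q≐X⊗Y W≐X⊗V t₀ t₁ t₀-zero t₁-zero t₀-suc t₁-suc m)

  -- The order hypotheses hold because each monomial involved has positive x-exponent: k in `q`, `W`
  -- and `X`, and l ≥ 1 in the summand of `U` with index l.
  RHS≡t₀ : ∀ n e → RHS k (n ∷ e) ≡ t₀ n (n ∷ e)
  RHS≡t₀ n e = trans
    (PochhammerLimit.poch-quotient {q = q} {U} {W} {X} (Order≥₁-mono r (k ∷ zeroV {r} Vec.++ zeroV))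
      (Order≥-sumL (allFin r) (λ j → mono (partWeight₀ (suc (toℕ j)) (unitV j)))
        (λ j → Order≥₁-mono (toℕ j) (0 ∷ unitV j Vec.++ zeroV)))
      (Order≥-sumL (allFin r) (λ j → monoK k k (suc (toℕ j)) zeroV (unitV j))
        (λ j → Order≥₁-mono r (suc (toℕ j) ∷ zeroV Vec.++ unitV j)))
      (Order≥₁-mono r (0 ∷ zeroV {r} Vec.++ zeroV)) (n ∷ e))
    (sym (t₀≐a n (n ∷ e)))

  HasWeight⇔weight₀≡ : ∀ n b us vs π → HasWeight k n b us vs π ⇔ (weight₀ π ≡ n ∷ b ∷ us Vec.++ vs)
  HasWeight⇔weight₀≡ n b us vs π = mk⇔
    (λ { (refl , refl , o≡ , e≡) → cong (λ v → _ ∷ _ ∷ v) (cong₂ Vec._++_ (tabulate≡ {v = us} o≡) (tabulate≡ {v = vs} e≡)) })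
    (λ eq → let n≡ , eq′ = Vecₚ.∷-injective eq
                b≡ , eq″ = Vecₚ.∷-injective eq′
                us≡ , vs≡ = Vecₚ.++-injective (residues (oddParts π)) us eq″
            in n≡ , b≡ , lookup≡ us≡ , lookup≡ vs≡)
    where
    tabulate≡ : ∀ {n} {f : Fin n → ℕ} {v} → (∀ j → f j ≡ Vec.lookup v j) → Vec.tabulate f ≡ v
    tabulate≡ p = trans (Vecₚ.tabulate-cong p) (Vecₚ.tabulate∘lookup _)
    lookup≡ : ∀ {n} {f : Fin n → ℕ} {v} → Vec.tabulate f ≡ v → ∀ j → f j ≡ Vec.lookup v j
    lookup≡ {f = f} p j = trans (sym (Vecₚ.lookup∘tabulate f j)) (cong (λ v → Vec.lookup v j) p)

  -- The largest part comes first, so it is itself a summand of `oddSum π`.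
  parts≤oddSum : ∀ {π} → DS k π → All (_≤ oddSum π) π
  parts≤oddSum {[]}    ds = []
  parts≤oddSum {p ∷ π} ds = ℕₚ.m≤m+n p _ ∷ All.map (λ q<p → ℕₚ.≤-trans (ℕₚ.<⇒≤ q<p) (ℕₚ.m≤m+n p _)) (DS⇒tail< ds)

theorem2p6 : (k : ℕ) .{{_ : NonZero k}} (a b : ℕ) (us vs : Vec ℕ (k ∸ 1)) →
    Σ (List (List ℕ)) (λ L →
    Unique L ×
    ((π : List ℕ) → (π ∈ L) ⇔ (DS k π × HasWeight k a b us vs π)) ×
    RHS k (a ∷ b ∷ us ++ vs) ≡ + length L)
theorem2p6 (suc r) a b us vs =
  List.filter P? (enum a) , Uniqueₚ.filter⁺ P? (enum-unique a) ,
  (λ π → mk⇔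
    (λ π∈ → let π∈enum , w≡ = ∈-filter⁻ P? {xs = enum a} π∈ in
      proj₁ (enum-sound a π∈enum) , Equivalence.from (HasWeight⇔weight₀≡ a b us vs π) w≡)
    (λ { (ds , hw) → ∈-filter⁺ P?
      -- Every part is at most `oddSum π`, which is a, and a ≤ a * k; so a blocks of part sizes
      -- suffice for this weight.
      (enum-complete a ds (All.map (λ p≤ → ℕₚ.≤-trans p≤ (ℕₚ.≤-trans (ℕₚ.≤-reflexive (proj₁ hw)) (ℕₚ.m≤m*n a k))) (parts≤oddSum ds)))
      (Equivalence.to (HasWeight⇔weight₀≡ a b us vs π) hw) })) ,
  trans (RHS≡t₀ a (b ∷ us ++ vs)) (sumL-mono≡length-filter weight₀ e (enum a))
  where
  open Enumeration r
  open Weights r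
  e : Vec ℕ (NV (suc r))
  e = a ∷ b ∷ us ++ vs
  P? : ∀ π → Dec (weight₀ π ≡ e)
  P? π = Vecₚ.≡-dec ℕ._≟_ (weight₀ π) e
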